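{- Let $A(\mathbb{F}_2^n,s)$ denote the maximum cardinality of a subset $X\subset\mathbb{F}_2^n$ such that the set of Hamming distances between distinct elements of $X$ has exactly $s$ elements. (1) If $8\le n\le 22$, $24\le n\le 33$, or $n\in\{36,37,44\}$, then $A(\mathbb{F}_2^n,3)=n+\binom{n}{3}$. (2) If $10\le n\le 47$, then $A(\mathbb{F}_2^n,4)=1+\binom{n}{2}+\binom{n}{4}$.
   Context: The Hamming distance on $\mathbb{F}_2^n$ is $\tau(x,y)=|\{i: x_i\ne y_i\}|$. -}

module Defs where

open import Data.Bool using (Bool; _xor_; if_then_else_)
open import Data.Nat using (ℕ; zero; suc; _+_; _≤_)
open import Data.Vec using (Vec; []; _∷_)
open import Data.List using (List; length)
open import Data.List.Membership.Propositional using (_∈_)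
open import Data.List.Relation.Unary.Unique.Propositional using (Unique)
open import Data.Product using (Σ; ∃; _×_)
open import Function.Bundles using (_⇔_)
open import Relation.Binary.PropositionalEquality using (_≡_; _≢_)

F₂^ : ℕ → Set
F₂^ n = Vec Bool n

hamming : ∀ {n} → F₂^ n → F₂^ n → ℕ
hamming [] [] = 0
hamming (a ∷ x) (b ∷ y) = (if a xor b then 1 else 0) + hamming x y

IsDistanceOf : ∀ {n} → List (F₂^ n) → ℕ → Set
IsDistanceOf X d = ∃ λ x → ∃ λ y → x ∈ X × y ∈ X × x ≢ y × hamming x y ≡ d

HasExactlyDistances : ∀ {n} → ℕ → List (F₂^ n) → Set
HasExactlyDistances s X =
  Σ (List ℕ) λ D → Unique D × length D ≡ s × (∀ d → (d ∈ D ⇔ IsDistanceOf X d))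

IsSDistanceSet : (n s : ℕ) → List (F₂^ n) → Set
IsSDistanceSet n s X = Unique X × HasExactlyDistances s X

A-is : (n s m : ℕ) → Set
A-is n s m =
  (∃ λ X → IsSDistanceSet n s X × length X ≡ m)
  × (∀ X → IsSDistanceSet n s X → length X ≤ m)

{-# OPTIONS --safe #-}
module Submission where

-- For a distance set D put F(t) = Π_{d ∈ D} 2(d − t) and expand F = Σ f_k K_k in Krawtchouk polynomials.  On a code X with
-- distances in D the matrix F(τ(x, y)) is F(0) times the identity, while K_k(τ(x, y)) is a sum of (n choose k) rank-one
-- positive matrices, one for each character of weight k.  Three bounds follow.
--   * Integrality: if Π_{e ≠ d} (e − d) does not divide Π_{e ≠ d} e for some d ∈ D, then |X| ≤ Σ_{k < s} (n choose k).
--   * Signs: |X| ≤ Σ (n choose k) over the k with f_k > 0.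
--   * Linear programming: if G = Σ g_k K_k with g_k ≥ 0 satisfies G(0) + M G(d) < 0 for all d ∈ D, then |X| ≤ M.
-- Only finitely many D satisfy the divisibility conditions, and each of them is settled for each n by one of the other two
-- bounds.  Equality is attained by the words of weight 1 or 3, respectively 0, 2 or 4.

open import Defs
open import Data.Nat as ℕ using (ℕ; zero; suc; _≤_; s≤s; z≤n)
import Data.Nat.Properties as ℕ
open import Data.Bool using (Bool; true; false; if_then_else_; T; _∧_; _∨_; _xor_; not)
open import Data.Bool.ListAction using (all; any)
open import Data.Bool.Properties using (T-∧; T-∨)
open import Data.Integer as ℤ using (ℤ; 0ℤ; 1ℤ; -1ℤ; ∣_∣)
import Data.Integer.Properties as ℤ
open import Data.Integer.Divisibility.Signed using (_∣_; divides; ∣m∣n⇒∣m+n; 0∣⇒≡0; ∣⇒∣ᵤ; ∣ᵤ⇒∣; *-monoˡ-∣; ∣m⇒∣-m)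
open import Data.Integer.Tactic.RingSolver using (solve-∀)
open import Data.List using (List; []; _∷_; [_]; _++_; length; map; concatMap; filter; upTo)
open import Data.List.Properties using (length-++; length-map; length-upTo; map-id; map-∘)
open import Data.List.Membership.DecPropositional ℕ._≟_ using (_∈?_)
open import Data.List.Membership.Propositional using (_∈_; find)
open import Data.List.Membership.Propositional.Properties
  using (∈-∃++; ∈-map⁺; ∈-map⁻; ∈-++⁺ˡ; ∈-++⁺ʳ; ∈-++⁻; ∈-filter⁺; ∈-upTo⁺)
open import Data.List.Relation.Binary.Permutation.Propositional using (_↭_; ↭⇒↭ₛ; ↭-refl; ↭-trans; prep)
open import Data.List.Relation.Binary.Permutation.Propositional.Properties
  using (shift; ↭-length; ∈-resp-↭; All-resp-↭)
import Data.List.Relation.Binary.Permutation.Setoid.Properties as Permutation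
open import Data.List.Relation.Unary.All as All using (All; []; _∷_)
import Data.List.Relation.Unary.All.Properties as All
open import Data.List.Relation.Unary.AllPairs using (AllPairs; []; _∷_)
import Data.List.Relation.Unary.AllPairs.Properties as AllPairs
open import Data.List.Relation.Unary.Any as Any using (Any; here; there; any?)
import Data.List.Relation.Unary.Any.Properties as Any
open import Data.List.Relation.Unary.Unique.DecPropositional ℕ._≟_ using (unique?)
open import Data.List.Relation.Unary.Unique.Propositional using (Unique)
import Data.List.Relation.Unary.Unique.Propositional.Properties as Unique
open import Data.Nat.Combinatorics using (_C_; nCk+nC[k+1]≡[n+1]C[k+1]; k>n⇒nCk≡0; nC1≡n)
open import Data.Nat.Coprimality using (coprime-/gcd; coprime-factors)
import Data.Nat.Divisibility as ℕ
import Data.Nat.DivMod as ℕ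
open import Data.Nat.GCD using (gcd; gcd[m,n]∣m; gcd[m,n]∣n; gcd[m,n]≢0)
open import Data.Nat.ListAction using (sum)
open import Data.Product using (∃; _×_; _,_; proj₁; proj₂)
open import Data.Sum using (_⊎_; inj₁; inj₂)
open import Data.Unit using (tt)
open import Data.Vec using (Vec; []; _∷_; replicate)
import Data.Vec as Vec
open import Function using (_∘_; _on_; case_of_)
open import Function.Bundles using (Equivalence; _⇔_; mk⇔)
open import Relation.Binary.PropositionalEquality
  using (_≡_; _≢_; refl; sym; trans; cong; cong₂; subst; subst₂; setoid; module ≡-Reasoning)
open import Relation.Nullary using (Dec; ¬_; ¬?; yes; no; contradiction)
open import Relation.Nullary.Decidable using (from-yes; _×-dec_; _⊎-dec_; _→-dec_)

open Equivalence using (to; from)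

-- The claimed values are the sign bounds for D = {2, 4, 6} and D = {2, 4, 6, 8}. In the first case
-- f_2 = -6(n - 8), and f_0 is n - 8 times a negative factor, so from n = 8 on only the characters
-- of weight 1 and 3 count. In the second case f_3 = -24(n - 10), and f_1 is n - 10 times a negative
-- factor, so from n = 10 on only weights 0, 2 and 4 can count. Length 23 is missing from (1)
-- because the even-weight subcode of the binary Golay code has 2048 words with distances 8, 12, 16,
-- more than 23 + (23 choose 3) = 1794. The integrality and sign bounds share one mechanism: a code
-- with more words than there are characters to kill carries a nonzero integral weight w orthogonal
-- to all of them, and F is then applied to w, row by row or as a quadratic form. Everything stays
-- in ℤ, since the integrality bound needs integral weights and the finite verification is done by
-- evaluation: elimination avoids division, and the coefficients f_k are integers. The divisibility
-- conditions do not mention n, so the surviving distance sets are listed once and shared by all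
-- lengths.

private variable
  A B : Set
  n : ℕ

module Bounds where

  open import Data.Integer using (_+_; _-_; _*_; -_; _≤ᵇ_)

  -- Finite sums of integers

  ∑ : List A → (A → ℤ) → ℤ
  ∑ []       f = 0ℤ
  ∑ (x ∷ xs) f = f x + ∑ xs f

  ∑-cong : ∀ (xs : List A) {f g} → (∀ {x} → x ∈ xs → f x ≡ g x) → ∑ xs f ≡ ∑ xs g
  ∑-cong []       eq = refl
  ∑-cong (x ∷ xs) eq = cong₂ _+_ (eq (here refl)) (∑-cong xs (eq ∘ there))

  ∑-zero : ∀ (xs : List A) {f} → (∀ {x} → x ∈ xs → f x ≡ 0ℤ) → ∑ xs f ≡ 0ℤ
  ∑-zero []       eq = refl
  ∑-zero (x ∷ xs) eq = cong₂ _+_ (eq (here refl)) (∑-zero xs (eq ∘ there))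

  ∑-++ : ∀ (xs ys : List A) f → ∑ (xs ++ ys) f ≡ ∑ xs f + ∑ ys f
  ∑-++ []       ys f = sym (ℤ.+-identityˡ _)
  ∑-++ (x ∷ xs) ys f = trans (cong (f x +_) (∑-++ xs ys f)) (sym (ℤ.+-assoc (f x) _ _))

  ∑-map : ∀ (h : A → B) xs f → ∑ (map h xs) f ≡ ∑ xs (f ∘ h)
  ∑-map h []       f = refl
  ∑-map h (x ∷ xs) f = cong (f (h x) +_) (∑-map h xs f)

  ∑-+ : ∀ (xs : List A) f g → ∑ xs (λ x → f x + g x) ≡ ∑ xs f + ∑ xs g
  ∑-+ []       f g = refl
  ∑-+ (x ∷ xs) f g = trans (cong (f x + g x +_) (∑-+ xs f g)) (interchange (f x) (g x) _ _)
    where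
    interchange : ∀ a b c d → a + b + (c + d) ≡ a + c + (b + d)
    interchange = solve-∀

  ∑-*ˡ : ∀ (xs : List A) c f → ∑ xs (λ x → c * f x) ≡ c * ∑ xs f
  ∑-*ˡ []       c f = sym (ℤ.*-zeroʳ c)
  ∑-*ˡ (x ∷ xs) c f = trans (cong (c * f x +_) (∑-*ˡ xs c f)) (sym (ℤ.*-distribˡ-+ c (f x) _))

  ∑-swap : ∀ (xs : List A) (ys : List B) (f : A → B → ℤ) →
    ∑ xs (λ x → ∑ ys (f x)) ≡ ∑ ys (λ y → ∑ xs (λ x → f x y))
  ∑-swap []       ys f = sym (∑-zero ys (λ _ → refl))
  ∑-swap (x ∷ xs) ys f = trans (cong (∑ ys (f x) +_) (∑-swap xs ys f)) (sym (∑-+ ys (f x) _))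

  ∑-nonNeg : ∀ (xs : List A) {f} → (∀ x → 0ℤ ℤ.≤ f x) → 0ℤ ℤ.≤ ∑ xs f
  ∑-nonNeg []       f≥0 = ℤ.≤-refl
  ∑-nonNeg (x ∷ xs) f≥0 = ℤ.+-mono-≤ (f≥0 x) (∑-nonNeg xs f≥0)

  ∑-∣ : ∀ {t} (xs : List A) {f} → (∀ {x} → x ∈ xs → t ∣ f x) → t ∣ ∑ xs f
  ∑-∣ []       t∣f = divides 0ℤ refl
  ∑-∣ (x ∷ xs) t∣f = ∣m∣n⇒∣m+n (t∣f (here refl)) (∑-∣ xs (t∣f ∘ there))

  -- Modulus 0 turns the conclusion into an equality, so one lemma serves both the sign bound (t =
  -- 0) and the congruences of the integrality bound. The `key` lets weighted points be compared by
  -- their words alone.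
  ∑-isolate : ∀ {t} {key : A → B} {xs g x} → AllPairs (_≢_ on key) xs → x ∈ xs →
    (∀ {y} → y ∈ xs → key x ≢ key y → t ∣ g y) → t ∣ ∑ xs g - g x
  ∑-isolate {t = t} {xs = x ∷ xs} {g} (x≢ ∷ _) (here refl) t∣g =
    subst (t ∣_) (cancel (g x) (∑ xs g)) (∑-∣ xs (λ y∈ → t∣g (there y∈) (All.lookup x≢ y∈)))
    where
    cancel : ∀ a b → b ≡ a + b - a
    cancel = solve-∀
  ∑-isolate {t = t} {xs = y ∷ xs} {g} {x} (y≢ ∷ xs!) (there x∈) t∣g =
    subst (t ∣_) (sym (ℤ.+-assoc (g y) _ _))
      (∣m∣n⇒∣m+n (t∣g (here refl) (All.lookup y≢ x∈ ∘ sym)) (∑-isolate xs! x∈ (t∣g ∘ there)))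

  -- Integral linear algebra

  moment : List (ℤ × A) → (A → ℤ) → ℤ
  moment W φ = ∑ W (λ w → proj₁ w * φ (proj₂ w))

  -- Gaussian elimination: φ is a pivot for the first point x, and the functions φ(x)ψ − ψ(x)φ vanish at x.
  kernel : (X : List A) (Φ : List (A → ℤ)) → length Φ ℕ.< length X →
    ∃ λ W → map proj₂ W ≡ X × Any (λ w → proj₁ w ≢ 0ℤ) W × All (λ φ → moment W φ ≡ 0ℤ) Φ
  kernel (x ∷ X) Φ Φ<X with any? (λ φ → ¬? (φ x ℤ.≟ 0ℤ)) Φ
  ... | no none =
    -- Every function vanishes at x, so the point mass at x will do.
    (1ℤ , x) ∷ map (0ℤ ,_) X , cong (x ∷_) (trans (sym (map-∘ X)) (map-id X)) , here (λ ()) ,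
    All.map (λ {φ} → vanish φ) (All.¬Any⇒All¬ Φ none)
    where
    vanish : ∀ φ → ¬ (φ x ≢ 0ℤ) → moment ((1ℤ , x) ∷ map (0ℤ ,_) X) φ ≡ 0ℤ
    vanish φ ¬φx≢0 with φ x ℤ.≟ 0ℤ
    ... | no φx≢0 = contradiction φx≢0 ¬φx≢0
    ... | yes φx≡0 = cong₂ _+_ (trans (ℤ.*-identityˡ (φ x)) φx≡0)
      (trans (∑-map (0ℤ ,_) X (λ w → proj₁ w * φ (proj₂ w))) (∑-zero X (λ _ → refl)))
  ... | yes some with find some
  ...   | φ , φ∈Φ , φx≢0 with ∈-∃++ φ∈Φ
  ...     | Φ₁ , Φ₂ , refl with kernel X (map elim (Φ₁ ++ Φ₂)) fewer
    where
    elim : (_ → ℤ) → _ → ℤ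
    elim ψ y = φ x * ψ y - ψ x * φ y
    fewer : length (map elim (Φ₁ ++ Φ₂)) ℕ.< length X
    fewer = subst (ℕ._< length X) (sym (trans (length-map elim (Φ₁ ++ Φ₂)) (length-++ Φ₁)))
      (ℕ.s<s⁻¹ (subst (ℕ._< suc (length X)) (trans (length-++ Φ₁) (ℕ.+-suc (length Φ₁) (length Φ₂))) Φ<X))
  ...       | W , refl , nonzero , vanish =
    -- Instead of dividing by φ(x), the weights of the other points are multiplied by it. The new
    -- moment of any ψ is then the old moment of φ(x)ψ - ψ(x)φ, which for ψ = φ is 0.
    (- moment W φ , x) ∷ map scale W , cong (x ∷_) (sym (map-∘ W)) ,
    there (Any.map⁺ (Any.map (λ c≢0 → c≢0 ∘ cancel _) nonzero)) ,
    All.++⁺ (All.map (λ {ψ} → step ψ) (All.++⁻ˡ Φ₁ vanish′))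
      (trans (moment-extend φ) (pivot (moment W φ) (φ x)) ∷ All.map (λ {ψ} → step ψ) (All.++⁻ʳ Φ₁ vanish′))
    where
    scale : ℤ × _ → ℤ × _
    scale (c , y) = φ x * c , y
    cancel : ∀ c → φ x * c ≡ 0ℤ → c ≡ 0ℤ
    cancel c eq with ℤ.i*j≡0⇒i≡0∨j≡0 (φ x) eq
    ... | inj₁ φx≡0 = contradiction φx≡0 φx≢0
    ... | inj₂ c≡0  = c≡0
    vanish′ = All.map⁻ vanish
    pivot : ∀ m a → - m * a + a * m ≡ 0ℤ
    pivot = solve-∀
    moment-extend : ∀ ψ → moment ((- moment W φ , x) ∷ map scale W) ψ ≡ - moment W φ * ψ x + φ x * moment W ψ
    moment-extend ψ = cong (- moment W φ * ψ x +_)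
      (trans (∑-map scale W _)
      (trans (∑-cong W (λ _ → ℤ.*-assoc (φ x) _ _)) (∑-*ˡ W (φ x) _)))
    distribute : ∀ a b c p q → c * (a * p - b * q) ≡ a * (c * p) + (- b) * (c * q)
    distribute = solve-∀
    moment-elim : ∀ ψ → moment W (λ y → φ x * ψ y - ψ x * φ y) ≡ - moment W φ * ψ x + φ x * moment W ψ
    moment-elim ψ = begin
      moment W (λ y → φ x * ψ y - ψ x * φ y)
        ≡⟨ ∑-cong W (λ {w} _ → distribute (φ x) (ψ x) (proj₁ w) (ψ (proj₂ w)) (φ (proj₂ w))) ⟩
      ∑ W (λ w → φ x * (proj₁ w * ψ (proj₂ w)) + (- ψ x) * (proj₁ w * φ (proj₂ w)))
        ≡⟨ ∑-+ W _ _ ⟩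
      ∑ W (λ w → φ x * (proj₁ w * ψ (proj₂ w))) + ∑ W (λ w → (- ψ x) * (proj₁ w * φ (proj₂ w)))
        ≡⟨ cong₂ _+_ (∑-*ˡ W (φ x) _) (∑-*ˡ W (- ψ x) _) ⟩
      φ x * moment W ψ + (- ψ x) * moment W φ
        ≡⟨ rearrange (φ x) (moment W ψ) (ψ x) (moment W φ) ⟩
      - moment W φ * ψ x + φ x * moment W ψ ∎
      where
      open ≡-Reasoning
      rearrange : ∀ a m b p → a * m + (- b) * p ≡ - p * b + a * m
      rearrange = solve-∀
    step : ∀ ψ → moment W (λ y → φ x * ψ y - ψ x * φ y) ≡ 0ℤ →
      moment ((- moment W φ , x) ∷ map scale W) ψ ≡ 0ℤ
    step ψ eq = trans (moment-extend ψ) (trans (sym (moment-elim ψ)) eq)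

  -- Characters and Krawtchouk polynomials

  -- These words play two roles: they index the characters of weight k, and they are the codewords
  -- of the extremal examples.
  words : ∀ n → ℕ → List (F₂^ n)
  words n       zero    = [ replicate n false ]
  words zero    (suc k) = []
  words (suc n) (suc k) = map (false ∷_) (words n (suc k)) ++ map (true ∷_) (words n k)

  length-words : ∀ n k → length (words n k) ≡ n C k
  length-words n       zero    = refl
  length-words zero    (suc k) = sym (k>n⇒nCk≡0 {0} {suc k} (s≤s z≤n))
  length-words (suc n) (suc k) = begin
    length (words (suc n) (suc k))
      ≡⟨ length-++ (map (false ∷_) (words n (suc k))) ⟩
    length (map (false ∷_) (words n (suc k))) ℕ.+ length (map (true ∷_) (words n k))
      ≡⟨ cong₂ ℕ._+_ (trans (length-map (false ∷_) (words n (suc k))) (length-words n (suc k)))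
                     (trans (length-map (true ∷_) (words n k)) (length-words n k)) ⟩
    n C suc k ℕ.+ n C k
      ≡⟨ ℕ.+-comm (n C suc k) (n C k) ⟩
    n C k ℕ.+ n C suc k
      ≡⟨ nCk+nC[k+1]≡[n+1]C[k+1] n k ⟩
    suc n C suc k ∎
    where open ≡-Reasoning

  sgn : Bool → ℤ
  sgn false = 1ℤ
  sgn true  = -1ℤ

  χ : F₂^ n → F₂^ n → ℤ
  χ []          []      = 1ℤ
  χ (false ∷ w) (b ∷ x) = χ w x
  χ (true  ∷ w) (b ∷ x) = sgn b * χ w x

  χ-trivial : (x : F₂^ n) → χ (replicate n false) x ≡ 1ℤ
  χ-trivial []      = refl
  χ-trivial (b ∷ x) = χ-trivial x

  -- The Krawtchouk polynomial K_k as a kernel on pairs of words. In this form positivity is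
  -- immediate; that the value depends only on the distance comes out of `nth-krawtchouk`.
  K : ℕ → F₂^ n → F₂^ n → ℤ
  K {n} k x y = ∑ (words n k) (λ w → χ w x * χ w y)

  K-zero : (x y : F₂^ n) → K 0 x y ≡ 1ℤ
  K-zero x y rewrite χ-trivial x | χ-trivial y = refl

  K-suc : ∀ k a b (x y : F₂^ n) →
    K (suc k) (a ∷ x) (b ∷ y) ≡ K (suc k) x y + sgn a * sgn b * K k x y
  K-suc {n} k a b x y = begin
    K (suc k) (a ∷ x) (b ∷ y)
      ≡⟨ ∑-++ (map (false ∷_) (words n (suc k))) _ f ⟩
    ∑ (map (false ∷_) (words n (suc k))) f + ∑ (map (true ∷_) (words n k)) f
      ≡⟨ cong₂ _+_ (∑-map (false ∷_) (words n (suc k)) f) (∑-map (true ∷_) (words n k) f) ⟩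
    K (suc k) x y + ∑ (words n k) (λ w → sgn a * χ w x * (sgn b * χ w y))
      ≡⟨ cong (K (suc k) x y +_) (trans (∑-cong (words n k) (λ {w} _ → interchange (sgn a) (χ w x) (sgn b) (χ w y)))
                                        (∑-*ˡ (words n k) (sgn a * sgn b) _)) ⟩
    K (suc k) x y + sgn a * sgn b * K k x y ∎
    where
    open ≡-Reasoning
    f : F₂^ (suc n) → ℤ
    f w = χ w (a ∷ x) * χ w (b ∷ y)
    interchange : ∀ p q r s → p * q * (r * s) ≡ p * r * (q * s)
    interchange = solve-∀

  -- The inner product of the ±1 vectors attached to two words at Hamming distance t.
  inner : ℕ → ℕ → ℤ
  inner n t = ℤ.+ n - ℤ.+ (2 ℕ.* t)

  ⟨_,_⟩ : F₂^ n → F₂^ n → ℤ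
  ⟨_,_⟩ {n} x y = inner n (hamming x y)

  sgn² : ∀ a b → (sgn a * sgn b) * (sgn a * sgn b) ≡ 1ℤ
  sgn² false false = refl
  sgn² false true  = refl
  sgn² true  false = refl
  sgn² true  true  = refl

  inner-agree : ∀ n t → inner (suc n) t ≡ 1ℤ + inner n t
  inner-agree n t = ℤ.+-assoc 1ℤ (ℤ.+ n) (- ℤ.+ (2 ℕ.* t))

  inner-differ : ∀ n t → inner (suc n) (suc t) ≡ -1ℤ + inner n t
  inner-differ n t = begin
    ℤ.+ suc n - ℤ.+ (2 ℕ.* suc t)       ≡⟨ cong (λ u → ℤ.+ suc n - ℤ.+ u) (ℕ.*-suc 2 t) ⟩
    1ℤ + ℤ.+ n - (ℤ.+ 2 + ℤ.+ (2 ℕ.* t)) ≡⟨ collect (ℤ.+ n) (ℤ.+ (2 ℕ.* t)) ⟩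
    -1ℤ + inner n t ∎
    where
    open ≡-Reasoning
    collect : ∀ p q → 1ℤ + p - (ℤ.+ 2 + q) ≡ -1ℤ + (p - q)
    collect = solve-∀

  ⟨⟩-∷ : ∀ a b (x y : F₂^ n) → ⟨ a ∷ x , b ∷ y ⟩ ≡ sgn a * sgn b + ⟨ x , y ⟩
  ⟨⟩-∷ {n} false false x y = inner-agree n (hamming x y)
  ⟨⟩-∷ {n} true  true  x y = inner-agree n (hamming x y)
  ⟨⟩-∷ {n} false true  x y = inner-differ n (hamming x y)
  ⟨⟩-∷ {n} true  false x y = inner-differ n (hamming x y)

  ⟨⟩*K-zero : (x y : F₂^ n) → ⟨ x , y ⟩ * K 0 x y ≡ K 1 x y
  ⟨⟩*K-zero x y = trans (cong (⟨ x , y ⟩ *_) (K-zero x y)) (trans (ℤ.*-identityʳ ⟨ x , y ⟩) (go x y))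
    where
    go : ∀ {n} (x y : F₂^ n) → ⟨ x , y ⟩ ≡ K 1 x y
    go []      []      = refl
    go (a ∷ x) (b ∷ y) = begin
      ⟨ a ∷ x , b ∷ y ⟩                    ≡⟨ ⟨⟩-∷ a b x y ⟩
      sgn a * sgn b + ⟨ x , y ⟩            ≡⟨ ℤ.+-comm (sgn a * sgn b) _ ⟩
      ⟨ x , y ⟩ + sgn a * sgn b            ≡⟨ cong₂ _+_ (go x y)
        (sym (trans (cong (sgn a * sgn b *_) (K-zero x y)) (ℤ.*-identityʳ _))) ⟩
      K 1 x y + sgn a * sgn b * K 0 x y    ≡⟨ K-suc 0 a b x y ⟨
      K 1 (a ∷ x) (b ∷ y) ∎
      where open ≡-Reasoning

  -- The three-term recurrence of the Krawtchouk polynomials. The inner product is the sum of the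
  -- characters of weight 1; multiplying these with the characters of weight k + 1 gives each
  -- character of weight k + 2 in k + 2 ways and each of weight k in n - k ways. The proof is by
  -- induction on the coordinates, where ε = `sgn a * sgn b` satisfies ε² = 1.
  ⟨⟩*K-suc : ∀ k (x y : F₂^ n) →
    ⟨ x , y ⟩ * K (suc k) x y ≡ ℤ.+ suc (suc k) * K (suc (suc k)) x y + (ℤ.+ n - ℤ.+ k) * K k x y
  ⟨⟩*K-suc zero    []      []      = refl
  ⟨⟩*K-suc (suc k) []      []      = sym (cong₂ _+_ (ℤ.*-zeroʳ (ℤ.+ suc (suc (suc k)))) (ℤ.*-zeroʳ (0ℤ - ℤ.+ suc k)))
  ⟨⟩*K-suc {suc n} zero    (a ∷ x) (b ∷ y)
    rewrite ⟨⟩-∷ a b x y | K-suc 1 a b x y | K-suc 0 a b x y | K-zero x y =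
    combine (sgn a * sgn b) ⟨ x , y ⟩ (ℤ.+ n) (K 1 x y) (K 2 x y) (sgn² a b)
      (trans (⟨⟩*K-suc zero x y) (cong (λ u → ℤ.+ 2 * K 2 x y + (ℤ.+ n - 0ℤ) * u) (K-zero x y)))
      (trans (sym (ℤ.*-identityʳ ⟨ x , y ⟩)) (trans (cong (⟨ x , y ⟩ *_) (sym (K-zero x y))) (⟨⟩*K-zero x y)))
    where
    open ≡-Reasoning
    expand : ∀ ε z K₁ → (ε + z) * (K₁ + ε * 1ℤ) ≡ z * K₁ + ε * K₁ + ε * z + ε * ε
    expand = solve-∀
    regroup : ∀ ε N K₁ K₂ → ℤ.+ 2 * K₂ + (N - 0ℤ) * 1ℤ + ε * K₁ + ε * K₁ + 1ℤ ≡ ℤ.+ 2 * (K₂ + ε * K₁) + (1ℤ + N - 0ℤ) * 1ℤ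
    regroup = solve-∀
    combine : ∀ ε z N K₁ K₂ → ε * ε ≡ 1ℤ → z * K₁ ≡ ℤ.+ 2 * K₂ + (N - 0ℤ) * 1ℤ → z ≡ K₁ →
      (ε + z) * (K₁ + ε * 1ℤ) ≡ ℤ.+ 2 * (K₂ + ε * K₁) + (1ℤ + N - 0ℤ) * 1ℤ
    combine ε z N K₁ K₂ ε² zK₁ zK₀ = begin
      (ε + z) * (K₁ + ε * 1ℤ)                ≡⟨ expand ε z K₁ ⟩
      z * K₁ + ε * K₁ + ε * z + ε * ε        ≡⟨ cong₂ _+_ (cong₂ _+_ (cong (_+ ε * K₁) zK₁) (cong (ε *_) zK₀)) ε² ⟩
      ℤ.+ 2 * K₂ + (N - 0ℤ) * 1ℤ + ε * K₁ + ε * K₁ + 1ℤ ≡⟨ regroup ε N K₁ K₂ ⟩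
      ℤ.+ 2 * (K₂ + ε * K₁) + (1ℤ + N - 0ℤ) * 1ℤ ∎
  ⟨⟩*K-suc {suc n} (suc k) (a ∷ x) (b ∷ y)
    rewrite ⟨⟩-∷ a b x y | K-suc (suc (suc k)) a b x y | K-suc (suc k) a b x y | K-suc k a b x y =
    combine (sgn a * sgn b) ⟨ x , y ⟩ (ℤ.+ n) (ℤ.+ k)
      (K k x y) (K (suc k) x y) (K (suc (suc k)) x y) (K (suc (suc (suc k))) x y) (sgn² a b)
      (⟨⟩*K-suc (suc k) x y) (⟨⟩*K-suc k x y)
    where
    open ≡-Reasoning
    expand : ∀ ε z K₁ K₂ → (ε + z) * (K₂ + ε * K₁) ≡ z * K₂ + ε * (z * K₁) + ε * K₂ + ε * ε * K₁
    expand = solve-∀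
    regroup : ∀ ε N k K₀ K₁ K₂ K₃ →
      ((ℤ.+ 3 + k) * K₃ + (N - (1ℤ + k)) * K₁) + ε * ((ℤ.+ 2 + k) * K₂ + (N - k) * K₀) + ε * K₂ + 1ℤ * K₁
        ≡ (ℤ.+ 3 + k) * (K₃ + ε * K₂) + (1ℤ + N - (1ℤ + k)) * (K₁ + ε * K₀)
    regroup = solve-∀
    combine : ∀ ε z N k K₀ K₁ K₂ K₃ → ε * ε ≡ 1ℤ →
      z * K₂ ≡ (ℤ.+ 3 + k) * K₃ + (N - (1ℤ + k)) * K₁ → z * K₁ ≡ (ℤ.+ 2 + k) * K₂ + (N - k) * K₀ →
      (ε + z) * (K₂ + ε * K₁) ≡ (ℤ.+ 3 + k) * (K₃ + ε * K₂) + (1ℤ + N - (1ℤ + k)) * (K₁ + ε * K₀)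
    combine ε z N k K₀ K₁ K₂ K₃ ε² zK₂ zK₁ = begin
      (ε + z) * (K₂ + ε * K₁)
        ≡⟨ expand ε z K₁ K₂ ⟩
      z * K₂ + ε * (z * K₁) + ε * K₂ + ε * ε * K₁
        ≡⟨ cong₂ _+_ (cong (_+ ε * K₂) (cong₂ _+_ zK₂ (cong (ε *_) zK₁))) (cong (_* K₁) ε²) ⟩
      ((ℤ.+ 3 + k) * K₃ + (N - (1ℤ + k)) * K₁) + ε * ((ℤ.+ 2 + k) * K₂ + (N - k) * K₀) + ε * K₂ + 1ℤ * K₁
        ≡⟨ regroup ε N k K₀ K₁ K₂ K₃ ⟩
      (ℤ.+ 3 + k) * (K₃ + ε * K₂) + (1ℤ + N - (1ℤ + k)) * (K₁ + ε * K₀) ∎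

  -- Krawtchouk coefficients of a product of linear factors

  rootPoly : List ℤ → ℤ → ℤ
  rootPoly []       z = 1ℤ
  rootPoly (a ∷ as) z = (z - a) * rootPoly as z

  head₀ : List ℤ → ℤ
  head₀ []      = 0ℤ
  head₀ (f ∷ _) = f

  -- fs lists the coefficients of K k, K (k+1), …, and p is the coefficient of K (k−1).
  mulLinear : ℕ → ℤ → ℕ → ℤ → List ℤ → List ℤ
  mulLinear n a k p []       = [ ℤ.+ k * p ]
  mulLinear n a k p (f ∷ fs) = ℤ.+ k * p - a * f + (ℤ.+ n - ℤ.+ k) * head₀ fs ∷ mulLinear n a (suc k) f fs

  coeffs : ℕ → List ℤ → List ℤ
  coeffs n []       = [ 1ℤ ]
  coeffs n (a ∷ as) = mulLinear n a 0 0ℤ (coeffs n as)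

  eval : ℕ → List ℤ → F₂^ n → F₂^ n → ℤ
  eval k []       x y = 0ℤ
  eval k (f ∷ fs) x y = f * K k x y + eval (suc k) fs x y

  -- On a tail of the coefficient list the product formula has two boundary terms: what the
  -- preceding coefficient p contributes to K_{k+1}, and what the first coefficient of the tail
  -- contributes to K_k, an entry outside this tail.
  eval-mulLinear-suc : ∀ a k p fs (x y : F₂^ n) →
    eval (suc k) (mulLinear n a (suc k) p fs) x y
      ≡ (⟨ x , y ⟩ - a) * eval (suc k) fs x y + ℤ.+ suc k * p * K (suc k) x y - (ℤ.+ n - ℤ.+ k) * head₀ fs * K k x y
  eval-mulLinear-suc {n} a k p []       x y = base (⟨ x , y ⟩ - a) (ℤ.+ suc k * p * K (suc k) x y) (ℤ.+ n - ℤ.+ k) (K k x y)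
    where
    base : ∀ z u v w → u + 0ℤ ≡ z * 0ℤ + u - v * 0ℤ * w
    base = solve-∀
  eval-mulLinear-suc {n} a k p (f ∷ fs) x y
    rewrite eval-mulLinear-suc a (suc k) f fs x y =
    combine a (ℤ.+ k) p f (head₀ fs) (eval (suc (suc k)) fs x y) ⟨ x , y ⟩ (ℤ.+ n)
      (K k x y) (K (suc k) x y) (K (suc (suc k)) x y)
      (⟨⟩*K-suc k x y)
    where
    open ≡-Reasoning
    expand : ∀ a k p f h E z N K₀ K₁ K₂ →
      ((1ℤ + k) * p - a * f + (N - (1ℤ + k)) * h) * K₁ + ((z - a) * E + (ℤ.+ 2 + k) * f * K₂ - (N - (1ℤ + k)) * h * K₁)
        ≡ (z - a) * E + (1ℤ + k) * p * K₁ - a * f * K₁ + f * ((ℤ.+ 2 + k) * K₂ + (N - k) * K₀) - (N - k) * f * K₀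
    expand = solve-∀
    collect : ∀ a k p f E z N K₀ K₁ →
      (z - a) * E + (1ℤ + k) * p * K₁ - a * f * K₁ + f * (z * K₁) - (N - k) * f * K₀
        ≡ (z - a) * (f * K₁ + E) + (1ℤ + k) * p * K₁ - (N - k) * f * K₀
    collect = solve-∀
    combine : ∀ a k p f h E z N K₀ K₁ K₂ → z * K₁ ≡ (ℤ.+ 2 + k) * K₂ + (N - k) * K₀ →
      ((1ℤ + k) * p - a * f + (N - (1ℤ + k)) * h) * K₁ + ((z - a) * E + (ℤ.+ 2 + k) * f * K₂ - (N - (1ℤ + k)) * h * K₁)
        ≡ (z - a) * (f * K₁ + E) + (1ℤ + k) * p * K₁ - (N - k) * f * K₀
    combine a k p f h E z N K₀ K₁ K₂ zK₁ = begin
      _ ≡⟨ expand a k p f h E z N K₀ K₁ K₂ ⟩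
      (z - a) * E + (1ℤ + k) * p * K₁ - a * f * K₁ + f * ((ℤ.+ 2 + k) * K₂ + (N - k) * K₀) - (N - k) * f * K₀
        ≡⟨ cong (λ u → (z - a) * E + (1ℤ + k) * p * K₁ - a * f * K₁ + f * u - (N - k) * f * K₀) zK₁ ⟨
      (z - a) * E + (1ℤ + k) * p * K₁ - a * f * K₁ + f * (z * K₁) - (N - k) * f * K₀
        ≡⟨ collect a k p f E z N K₀ K₁ ⟩
      _ ∎

  eval-mulLinear : ∀ a fs (x y : F₂^ n) → eval 0 (mulLinear n a 0 0ℤ fs) x y ≡ (⟨ x , y ⟩ - a) * eval 0 fs x y
  eval-mulLinear a []       x y = sym (ℤ.*-zeroʳ (⟨ x , y ⟩ - a))
  eval-mulLinear {n} a (f ∷ fs) x y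
    rewrite eval-mulLinear-suc a 0 f fs x y =
    combine a f (head₀ fs) (eval 1 fs x y) ⟨ x , y ⟩ (ℤ.+ n) (K 0 x y) (K 1 x y) (⟨⟩*K-zero x y)
    where
    open ≡-Reasoning
    expand : ∀ a f h E z N K₀ K₁ →
      (0ℤ - a * f + (N - 0ℤ) * h) * K₀ + ((z - a) * E + 1ℤ * f * K₁ - (N - 0ℤ) * h * K₀) ≡ (z - a) * E + f * K₁ - a * f * K₀
    expand = solve-∀
    collect : ∀ a f E z K₀ → (z - a) * E + f * (z * K₀) - a * f * K₀ ≡ (z - a) * (f * K₀ + E)
    collect = solve-∀
    combine : ∀ a f h E z N K₀ K₁ → z * K₀ ≡ K₁ →
      (0ℤ - a * f + (N - 0ℤ) * h) * K₀ + ((z - a) * E + 1ℤ * f * K₁ - (N - 0ℤ) * h * K₀) ≡ (z - a) * (f * K₀ + E)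
    combine a f h E z N K₀ K₁ zK₀ = begin
      _ ≡⟨ expand a f h E z N K₀ K₁ ⟩
      (z - a) * E + f * K₁ - a * f * K₀       ≡⟨ cong (λ u → (z - a) * E + f * u - a * f * K₀) zK₀ ⟨
      (z - a) * E + f * (z * K₀) - a * f * K₀ ≡⟨ collect a f E z K₀ ⟩
      _ ∎

  eval-coeffs : ∀ as (x y : F₂^ n) → eval 0 (coeffs n as) x y ≡ rootPoly as ⟨ x , y ⟩
  eval-coeffs []       x y = trans (ℤ.+-identityʳ _) (trans (ℤ.*-identityˡ _) (K-zero x y))
  eval-coeffs {n} (a ∷ as) x y = trans (eval-mulLinear a (coeffs n as) x y) (cong ((⟨ x , y ⟩ - a) *_) (eval-coeffs as x y))

  i*i≥0 : ∀ i → 0ℤ ℤ.≤ i * i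
  i*i≥0 (ℤ.+ n)    = subst (0ℤ ℤ.≤_) (ℤ.pos-* n n) (ℤ.+≤+ z≤n)
  i*i≥0 ℤ.-[1+ n ] = ℤ.+≤+ z≤n

  i*i>0 : ∀ i → i ≢ 0ℤ → 0ℤ ℤ.< i * i
  i*i>0 (ℤ.+ zero)  i≢0 = contradiction refl i≢0
  i*i>0 (ℤ.+ suc n) i≢0 = ℤ.+<+ (s≤s z≤n)
  i*i>0 ℤ.-[1+ n ]  i≢0 = ℤ.+<+ (s≤s z≤n)

  ∑-squares>0 : ∀ {xs} {f : A → ℤ} → Any (λ x → f x ≢ 0ℤ) xs → 0ℤ ℤ.< ∑ xs (λ x → f x * f x)
  ∑-squares>0 {xs = x ∷ xs} {f} (here fx≢0) = ℤ.+-mono-<-≤ (i*i>0 (f x) fx≢0) (∑-nonNeg xs (λ y → i*i≥0 (f y)))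
  ∑-squares>0 {xs = x ∷ xs} {f} (there p)   = ℤ.+-mono-≤-< (i*i≥0 (f x)) (∑-squares>0 p)

  -- Quadratic forms of kernels

  row : List (ℤ × A) → (A → A → ℤ) → A → ℤ
  row W G x = moment W (G x)

  quad : List (ℤ × A) → (A → A → ℤ) → ℤ
  quad W G = moment W (row W G)

  moment-linear : ∀ (W : List (ℤ × A)) f φ ψ → moment W (λ x → f * φ x + ψ x) ≡ f * moment W φ + moment W ψ
  moment-linear W f φ ψ = begin
    moment W (λ x → f * φ x + ψ x)
      ≡⟨ ∑-cong W (λ {w} _ → distribute (proj₁ w) f (φ (proj₂ w)) (ψ (proj₂ w))) ⟩
    ∑ W (λ w → f * (proj₁ w * φ (proj₂ w)) + proj₁ w * ψ (proj₂ w))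
      ≡⟨ ∑-+ W (λ w → f * (proj₁ w * φ (proj₂ w))) (λ w → proj₁ w * ψ (proj₂ w)) ⟩
    ∑ W (λ w → f * (proj₁ w * φ (proj₂ w))) + moment W ψ
      ≡⟨ cong (_+ moment W ψ) (∑-*ˡ W f (λ w → proj₁ w * φ (proj₂ w))) ⟩
    f * moment W φ + moment W ψ ∎
    where
    open ≡-Reasoning
    distribute : ∀ c f p q → c * (f * p + q) ≡ f * (c * p) + c * q
    distribute = solve-∀

  moment-cong : ∀ (W : List (ℤ × A)) {φ ψ} → (∀ x → φ x ≡ ψ x) → moment W φ ≡ moment W ψ
  moment-cong W eq = ∑-cong W (λ {w} _ → cong (proj₁ w *_) (eq (proj₂ w)))

  moment-zero : ∀ (W : List (ℤ × A)) → moment W (λ _ → 0ℤ) ≡ 0ℤ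
  moment-zero W = ∑-zero W (λ {w} _ → ℤ.*-zeroʳ (proj₁ w))

  moment-∑ : ∀ (W : List (ℤ × A)) (us : List B) (φ : B → A → ℤ) →
    moment W (λ x → ∑ us (λ u → φ u x)) ≡ ∑ us (λ u → moment W (φ u))
  moment-∑ W us φ = trans
    (∑-cong W (λ {w} _ → sym (∑-*ˡ us (proj₁ w) (λ u → φ u (proj₂ w)))))
    (∑-swap W us (λ w u → proj₁ w * φ u (proj₂ w)))

  moment-*ˡ : ∀ (W : List (ℤ × A)) f φ → moment W (λ x → f * φ x) ≡ f * moment W φ
  moment-*ˡ W f φ = trans (∑-cong W (λ {w} _ → exchange (proj₁ w) f (φ (proj₂ w)))) (∑-*ˡ W f (λ w → proj₁ w * φ (proj₂ w)))
    where
    exchange : ∀ c f p → c * (f * p) ≡ f * (c * p)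
    exchange = solve-∀

  row-K : ∀ W k (x : F₂^ n) → row W (K k) x ≡ ∑ (words n k) (λ u → χ u x * moment W (χ u))
  row-K {n} W k x = trans (moment-∑ W (words n k) (λ u y → χ u x * χ u y))
    (∑-cong (words n k) (λ {u} _ → moment-*ˡ W (χ u x) (χ u)))

  quad-K : ∀ W k → quad W (K {n} k) ≡ ∑ (words n k) (λ u → moment W (χ u) * moment W (χ u))
  quad-K {n} W k = begin
    quad W (K k)
      ≡⟨ moment-cong W (row-K W k) ⟩
    moment W (λ x → ∑ (words n k) (λ u → χ u x * moment W (χ u)))
      ≡⟨ moment-∑ W (words n k) (λ u x → χ u x * moment W (χ u)) ⟩
    ∑ (words n k) (λ u → moment W (λ x → χ u x * moment W (χ u)))
      ≡⟨ ∑-cong (words n k) (λ {u} _ →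
          trans (moment-cong W (λ x → ℤ.*-comm (χ u x) (moment W (χ u)))) (moment-*ˡ W (moment W (χ u)) (χ u))) ⟩
    ∑ (words n k) (λ u → moment W (χ u) * moment W (χ u)) ∎
    where open ≡-Reasoning

  quad-K≥0 : ∀ W k → 0ℤ ℤ.≤ quad W (K {n} k)
  quad-K≥0 {n} W k = subst (0ℤ ℤ.≤_) (sym (quad-K W k)) (∑-nonNeg (words n k) (λ u → i*i≥0 (moment W (χ u))))

  quad-linear : ∀ (W : List (ℤ × A)) f G H → quad W (λ x y → f * G x y + H x y) ≡ f * quad W G + quad W H
  quad-linear W f G H = trans (moment-cong W (λ x → moment-linear W f (G x) (H x))) (moment-linear W f (row W G) (row W H))

  quad-zero : ∀ (W : List (ℤ × A)) → quad W (λ _ _ → 0ℤ) ≡ 0ℤ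
  quad-zero W = trans (moment-cong W (λ _ → moment-zero W)) (moment-zero W)

  quad-cong : ∀ (W : List (ℤ × A)) {G H} → (∀ x y → G x y ≡ H x y) → quad W G ≡ quad W H
  quad-cong W eq = moment-cong W (λ x → moment-cong W (eq x))

  -- Weights orthogonal to whole layers of characters

  dim : ℕ → List ℕ → ℕ
  dim n ks = sum (map (n C_) ks)

  layers : ∀ n → List ℕ → List (F₂^ n)
  layers n = concatMap (words n)

  length-layers : ∀ n ks → length (layers n ks) ≡ dim n ks
  length-layers n []       = refl
  length-layers n (k ∷ ks) = trans (length-++ (words n k)) (cong₂ ℕ._+_ (length-words n k) (length-layers n ks))

  Vanishes : List (ℤ × F₂^ n) → ℕ → Set
  Vanishes {n} W k = ∀ {u} → u ∈ words n k → moment W (χ u) ≡ 0ℤ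

  vanishes : ∀ W ks → All (λ u → moment W (χ u) ≡ 0ℤ) (layers n ks) → All (Vanishes W) ks
  vanishes     W []       _ = []
  vanishes {n} W (k ∷ ks) v = All.lookup (All.++⁻ˡ (words n k) v) ∷ vanishes W ks (All.++⁻ʳ (words n k) v)

  orthogonal : ∀ (X : List (F₂^ n)) ks → dim n ks ℕ.< length X →
    ∃ λ W → map proj₂ W ≡ X × Any (λ w → proj₁ w ≢ 0ℤ) W × All (Vanishes W) ks
  orthogonal {n} X ks d<X =
    let W , W≡X , nonzero , v = kernel X (map χ (layers n ks)) (subst (ℕ._< length X) (sym size) d<X)
    in W , W≡X , nonzero , vanishes W ks (All.map⁻ v)
    where
    size : length (map χ (layers n ks)) ≡ dim n ks
    size = trans (length-map χ (layers n ks)) (length-layers n ks)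

  row-vanishes : ∀ {W k} → Vanishes W k → (x : F₂^ n) → row W (K k) x ≡ 0ℤ
  row-vanishes {n} {W} {k} v x = trans (row-K W k x)
    (∑-zero (words n k) (λ {u} u∈ → trans (cong (χ u x *_) (v u∈)) (ℤ.*-zeroʳ (χ u x))))

  quad-vanishes : ∀ {W k} → Vanishes W k → quad W (K {n} k) ≡ 0ℤ
  quad-vanishes {W = W} {k} v = trans (moment-cong W (row-vanishes {W = W} {k} v)) (moment-zero W)

  range : ℕ → ℕ → List ℕ
  range k zero    = []
  range k (suc l) = k ∷ range (suc k) l

  -- The integrality bound needs an equation at every single word, for which the vanishing of a
  -- quadratic form would be too weak.
  row-eval-vanishes : ∀ W k fs → All (Vanishes W) (range k (length fs)) → (x : F₂^ n) → row W (eval k fs) x ≡ 0ℤ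
  row-eval-vanishes W k []       _        x = moment-zero W
  row-eval-vanishes W k (f ∷ fs) (v ∷ vs) x = trans (moment-linear W f (K k x) (eval (suc k) fs x))
    (cong₂ _+_ (trans (cong (f *_) (row-vanishes {W = W} {k} v x)) (ℤ.*-zeroʳ f)) (row-eval-vanishes W (suc k) fs vs x))

  -- Zero coefficients must not be counted: for D = {2, 4, 6} and n = 8 both f_0 and f_2 are 0, and
  -- for D = {2, 4, 6, 8} and n = 10 both f_1 and f_3 are.
  positives : ℕ → List ℤ → List ℕ
  positives k []       = []
  positives k (f ∷ fs) = if f ≤ᵇ 0ℤ then positives (suc k) fs else k ∷ positives (suc k) fs

  quad-eval≤0 : ∀ W k fs → All (Vanishes W) (positives k fs) → quad W (eval {n} k fs) ℤ.≤ 0ℤ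
  quad-eval≤0 W k []       _ = ℤ.≤-reflexive (quad-zero W)
  quad-eval≤0 {n} W k (f ∷ fs) v with f ≤ᵇ 0ℤ in eq
  ... | true  = subst (ℤ._≤ 0ℤ) (sym (quad-linear W f (K k) (eval (suc k) fs)))
    (ℤ.+-mono-≤ (nonPos (subst T (sym eq) _) (quad-K≥0 W k)) (quad-eval≤0 W (suc k) fs v))
    where
    nonPos : T (f ≤ᵇ 0ℤ) → ∀ {i} → 0ℤ ℤ.≤ i → f * i ℤ.≤ 0ℤ
    nonPos f≤0 {i} i≥0 = ℤ.*-monoʳ-≤-nonNeg i {{ℤ.nonNegative i≥0}} {f} {0ℤ} (ℤ.≤ᵇ⇒≤ f≤0)
  ... | false with v₀ ∷ vs ← v = subst (ℤ._≤ 0ℤ) (sym (quad-linear W f (K k) (eval (suc k) fs)))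
    (ℤ.+-mono-≤ (ℤ.≤-reflexive (trans (cong (f *_) (quad-vanishes {W = W} {k} v₀)) (ℤ.*-zeroʳ f)))
      (quad-eval≤0 W (suc k) fs vs))

  -- The annihilator polynomial

  -- The factor 2(d - t) is ⟨x , y⟩ - (n - 2d) for words at distance t. Hence the product is monic
  -- in the inner product, and the recurrence expands it with integral coefficients.
  annih : List ℕ → ℕ → ℤ
  annih []      t = 1ℤ
  annih (d ∷ D) t = (ℤ.+ (2 ℕ.* d) - ℤ.+ (2 ℕ.* t)) * annih D t

  annih-root : ∀ {D t} → t ∈ D → annih D t ≡ 0ℤ
  annih-root {D = d ∷ D} {t} (here refl) = cong (_* annih D t) (ℤ.+-inverseʳ (ℤ.+ (2 ℕ.* t)))
  annih-root {D = d ∷ D} {t} (there t∈D) = trans (cong (e *_) (annih-root t∈D)) (ℤ.*-zeroʳ e)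
    where e = ℤ.+ (2 ℕ.* d) - ℤ.+ (2 ℕ.* t)

  annih-zero>0 : ∀ {D} → All (0 ℕ.<_) D → 0ℤ ℤ.< annih D 0
  annih-zero>0 []         = ℤ.+<+ (s≤s z≤n)
  annih-zero>0 {suc d ∷ D} (_ ∷ ps) = subst (ℤ._< annih (suc d ∷ D) 0) (ℤ.*-zeroʳ (ℤ.+ (2 ℕ.* suc d) - 0ℤ))
    (ℤ.*-monoˡ-<-pos (ℤ.+ (2 ℕ.* suc d) - 0ℤ) (annih-zero>0 ps))

  rootPoly-inner : ∀ n D t → rootPoly (map (inner n) D) (inner n t) ≡ annih D t
  rootPoly-inner n []      t = refl
  rootPoly-inner n (d ∷ D) t = cong₂ _*_ (difference (ℤ.+ n) (ℤ.+ (2 ℕ.* t)) (ℤ.+ (2 ℕ.* d))) (rootPoly-inner n D t)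
    where
    difference : ∀ N p q → (N - p) - (N - q) ≡ q - p
    difference = solve-∀

  annihCoeffs : ℕ → List ℕ → List ℤ
  annihCoeffs n D = coeffs n (map (inner n) D)

  eval-annih : ∀ D (x y : F₂^ n) → eval 0 (annihCoeffs n D) x y ≡ annih D (hamming x y)
  eval-annih {n} D x y = trans (eval-coeffs (map (inner n) D) x y) (rootPoly-inner n D (hamming x y))

  length-mulLinear : ∀ n a k p fs → length (mulLinear n a k p fs) ≡ suc (length fs)
  length-mulLinear n a k p []       = refl
  length-mulLinear n a k p (f ∷ fs) = cong suc (length-mulLinear n a (suc k) f fs)

  length-annihCoeffs : ∀ n D → length (annihCoeffs n D) ≡ suc (length D)
  length-annihCoeffs n []      = refl
  length-annihCoeffs n (d ∷ D) =
    trans (length-mulLinear n (inner n d) 0 0ℤ (annihCoeffs n D)) (cong suc (length-annihCoeffs n D))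

  hamming-self : (x : F₂^ n) → hamming x x ≡ 0
  hamming-self []          = refl
  hamming-self (false ∷ x) = hamming-self x
  hamming-self (true  ∷ x) = hamming-self x

  -- The sign bound

  HasDistancesIn : (ℕ → Set) → List (F₂^ n) → Set
  HasDistancesIn P X = ∀ {x y} → x ∈ X → y ∈ X → x ≢ y → P (hamming x y)

  distinct : ∀ {W : List (ℤ × A)} → Unique (map proj₂ W) → AllPairs (_≢_ on proj₂) W
  distinct = AllPairs.map⁻

  -- If w is orthogonal to the characters of weight k for every f_k > 0, then F(0) Σ_x w(x)² = Σ_k f_k Σ_u (Σ_x w(x) χ_u(x))² ≤ 0.
  signBound : ∀ {D} {X : List (F₂^ n)} → Unique X → All (0 ℕ.<_) D → HasDistancesIn (_∈ D) X →
    length X ℕ.≤ dim n (positives 0 (annihCoeffs n D))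
  signBound {n} {D} {X} X! D>0 dist = ℕ.≮⇒≥ λ d<X →
    let W , W≡X , nonzero , v = orthogonal X ks d<X
        W!    = subst Unique (sym W≡X) X!
        distW = subst (HasDistancesIn (_∈ D)) (sym W≡X) dist
    in ℤ.<⇒≱ (positive W nonzero) (subst (ℤ._≤ 0ℤ) (energy W W! distW) (quad-eval≤0 W 0 (annihCoeffs n D) v))
    where
    ks = positives 0 (annihCoeffs n D)
    positive : ∀ W → Any (λ w → proj₁ w ≢ 0ℤ) W → 0ℤ ℤ.< annih D 0 * ∑ W (λ w → proj₁ w * proj₁ w)
    positive W nz = subst (ℤ._< annih D 0 * ∑ W (λ w → proj₁ w * proj₁ w)) (ℤ.*-zeroʳ (annih D 0))
      (ℤ.*-monoˡ-<-pos (annih D 0) {{ℤ.positive (annih-zero>0 D>0)}} (∑-squares>0 nz))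
    energy : ∀ W → Unique (map proj₂ W) → HasDistancesIn (_∈ D) (map proj₂ W) →
      quad W (eval 0 (annihCoeffs n D)) ≡ annih D 0 * ∑ W (λ w → proj₁ w * proj₁ w)
    energy W W! dist = begin
      quad W (eval 0 (annihCoeffs n D))
        ≡⟨ quad-cong W (eval-annih D) ⟩
      quad W (λ x y → annih D (hamming x y))
        ≡⟨ ∑-cong W (λ {w} w∈ → trans (cong (proj₁ w *_) (diagonal w∈)) (exchange (proj₁ w) (annih D 0))) ⟩
      ∑ W (λ w → annih D 0 * (proj₁ w * proj₁ w))
        ≡⟨ ∑-*ˡ W (annih D 0) (λ w → proj₁ w * proj₁ w) ⟩
      annih D 0 * ∑ W (λ w → proj₁ w * proj₁ w) ∎
      where
      open ≡-Reasoning
      exchange : ∀ c a → c * (c * a) ≡ a * (c * c)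
      exchange = solve-∀
      diagonal : ∀ {w} → w ∈ W → row W (λ x y → annih D (hamming x y)) (proj₂ w) ≡ proj₁ w * annih D 0
      -- Divisibility by 0 is equality, so `∑-isolate` with modulus 0 leaves only the diagonal term
      -- of the row.
      diagonal {c , x} w∈ = trans (ℤ.i-j≡0⇒i≡j _ _ (0∣⇒≡0 (∑-isolate {key = proj₂} (distinct W!) w∈ offDiagonal)))
        (cong (λ t → c * annih D t) (hamming-self x))
        where
        offDiagonal : ∀ {w′} → w′ ∈ W → x ≢ proj₂ w′ → 0ℤ ∣ proj₁ w′ * annih D (hamming x (proj₂ w′))
        offDiagonal {w′} w′∈ x≢y = divides 0ℤ (trans
          (cong (proj₁ w′ *_) (annih-root (dist (∈-map⁺ proj₂ w∈) (∈-map⁺ proj₂ w′∈) x≢y)))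
          (ℤ.*-zeroʳ (proj₁ w′)))

  -- Divisibility by all powers and the integrality bound

  n<2^n : ∀ n → n ℕ.< 2 ℕ.^ n
  n<2^n zero    = s≤s z≤n
  n<2^n (suc n) = ℕ.≤-trans (ℕ.+-mono-≤ (ℕ.m^n>0 2 n) (n<2^n n))
    (ℕ.≤-reflexive (cong (2 ℕ.^ n ℕ.+_) (sym (ℕ.+-identityʳ (2 ℕ.^ n)))))

  -- For β ≥ 2 and m > 0 the power β^m exceeds m and cannot divide it; for β = 0 the first power
  -- already forces m = 0.
  powers∣⇒≡0 : ∀ {β m} → β ≢ 1 → (∀ k → β ℕ.^ k ℕ.∣ m) → m ≡ 0
  powers∣⇒≡0 {zero}          β≢1 β∣m = ℕ.0∣⇒≡0 (β∣m 1)
  powers∣⇒≡0 {suc zero}      β≢1 β∣m = contradiction refl β≢1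
  powers∣⇒≡0 {suc (suc β)} {zero}    β≢1 β∣m = refl
  powers∣⇒≡0 {suc (suc β)} {m@(suc _)} β≢1 β∣m = contradiction (ℕ.∣⇒≤ (β∣m m))
    (ℕ.<⇒≱ (ℕ.<-≤-trans (n<2^n m) (ℕ.^-monoˡ-≤ m (s≤s (s≤s z≤n)))))

  -- A nonzero integral weight orthogonal to all characters of weight at most |D′| satisfies a w(x) = −b Σ w(y), summed over
  -- the y at distance d from x; if b ∤ a, every w(x) is divisible by all powers of b / gcd(b, a) ≠ 1.
  integralityBound : ∀ {d D′} {X : List (F₂^ n)} → Unique X → HasDistancesIn (λ t → t ≡ d ⊎ t ∈ D′) X →
    ¬ (∣ annih D′ d ∣ ℕ.∣ ∣ annih D′ 0 ∣) → length X ℕ.≤ dim n (range 0 (suc (length D′)))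
  integralityBound {n} {d} {D′} {X} X! dist b∤a = ℕ.≮⇒≥ λ d<X →
    let W , W≡X , nonzero , v = orthogonal X (range 0 (suc (length D′))) d<X
        W!    = subst Unique (sym W≡X) X!
        distW = subst (HasDistancesIn (λ t → t ≡ d ⊎ t ∈ D′)) (sym W≡X) dist
        _ , w∈ , c≢0 = find nonzero
    in c≢0 (ℤ.∣i∣≡0⇒i≡0 (powers∣⇒≡0 β≢1 (λ k → divisible W W! distW v k w∈)))
    where
    a = ∣ annih D′ 0 ∣
    b = ∣ annih D′ d ∣
    -- Since b divides 0, the assumption b ∤ a excludes a = 0.
    g≢0 : gcd b a ≢ 0
    g≢0 = gcd[m,n]≢0 b a (inj₂ λ a≡0 → b∤a (subst (b ℕ.∣_) (sym a≡0) (b ℕ.∣0)))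
    instance
      g-nonZero : ℕ.NonZero (gcd b a)
      g-nonZero = ℕ.≢-nonZero g≢0
    α = a ℕ./ gcd b a
    β = b ℕ./ gcd b a
    αg≡a : α ℕ.* gcd b a ≡ a
    αg≡a = ℕ.m/n*n≡m (gcd[m,n]∣n b a)
    βg≡b : β ℕ.* gcd b a ≡ b
    βg≡b = ℕ.m/n*n≡m (gcd[m,n]∣m b a)
    -- If β were 1, then b would be the gcd and hence divide a.
    β≢1 : β ≢ 1
    β≢1 β≡1 = b∤a (subst (ℕ._∣ a)
      (trans (sym (ℕ.*-identityˡ (gcd b a))) (trans (cong (ℕ._* gcd b a) (sym β≡1)) βg≡b)) (gcd[m,n]∣n b a))
    divisible : ∀ W → Unique (map proj₂ W) → HasDistancesIn (λ t → t ≡ d ⊎ t ∈ D′) (map proj₂ W) →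
      All (Vanishes W) (range 0 (suc (length D′))) → ∀ k {w} → w ∈ W → β ℕ.^ k ℕ.∣ ∣ proj₁ w ∣
    divisible W W! dist v zero    w∈ = ℕ.1∣ _
    divisible W W! dist v (suc k) {c , x} w∈ =
      -- β^(k+1) divides β w(x) by the induction hypothesis and α w(x) by the row equation with the
      -- gcd cancelled. As α and β are coprime, it divides w(x).
      coprime-factors (coprime-/gcd b a) (ℕ.*-monoʳ-∣ β (divisible W W! dist v k w∈) , ℕ.*-cancelʳ-∣ (gcd b a) scaled)
      where
      q = β ℕ.^ k
      -- The annihilator of D′ has degree |D′| in the inner product, so it lies in the span of K_0,
      -- ..., K_|D′|, all of which w kills.
      rowZero : row W (λ x y → annih D′ (hamming x y)) x ≡ 0ℤ
      rowZero = trans (sym (moment-cong W (eval-annih D′ x)))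
        (row-eval-vanishes W 0 (annihCoeffs n D′)
          (subst (λ l → All (Vanishes W) (range 0 l)) (sym (length-annihCoeffs n D′)) v) x)
      offDiagonal : ∀ {w′} → w′ ∈ W → x ≢ proj₂ w′ → ℤ.+ q * annih D′ d ∣ proj₁ w′ * annih D′ (hamming x (proj₂ w′))
      offDiagonal {c′ , y} w′∈ x≢y with dist (∈-map⁺ proj₂ w∈) (∈-map⁺ proj₂ w′∈) x≢y
      ... | inj₂ t∈D′ = divides 0ℤ (trans (cong (c′ *_) (annih-root t∈D′)) (ℤ.*-zeroʳ c′))
      ... | inj₁ t≡d  = subst (λ t → ℤ.+ q * annih D′ d ∣ c′ * annih D′ t) (sym t≡d)
        (*-monoˡ-∣ (annih D′ d) {ℤ.+ q} {c′} (∣ᵤ⇒∣ (divisible W W! dist v k w′∈)))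
      isolated : ℤ.+ q * annih D′ d ∣ c * annih D′ 0
      isolated = subst (ℤ.+ q * annih D′ d ∣_)
        (trans (cong (λ r → - (r - c * annih D′ (hamming x x))) rowZero)
          (trans (negate (c * annih D′ (hamming x x))) (cong (λ t → c * annih D′ t) (hamming-self x))))
        (∣m⇒∣-m (∑-isolate {key = proj₂} (distinct W!) w∈ offDiagonal))
        where
        negate : ∀ i → - (0ℤ - i) ≡ i
        negate = solve-∀
      scaled : β ℕ.* q ℕ.* gcd b a ℕ.∣ α ℕ.* ∣ c ∣ ℕ.* gcd b a
      scaled = subst₂ ℕ._∣_
        (trans (ℤ.abs-* (ℤ.+ q) (annih D′ d)) (trans (cong (q ℕ.*_) (sym βg≡b)) (rearrange q β (gcd b a))))
        (trans (ℤ.abs-* c (annih D′ 0)) (trans (cong (∣ c ∣ ℕ.*_) (sym αg≡a)) (rearrange ∣ c ∣ α (gcd b a))))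
        (∣⇒∣ᵤ isolated)
        where
        rearrange : ∀ i j k → i ℕ.* (j ℕ.* k) ≡ j ℕ.* i ℕ.* k
        rearrange i j k = trans (sym (ℕ.*-assoc i j k)) (cong (ℕ._* k) (ℕ.*-comm i j))

  -- Krawtchouk numbers

  nth : A → List A → ℕ → A
  nth z []       i       = z
  nth z (x ∷ xs) zero    = x
  nth z (x ∷ xs) (suc i) = nth z xs i

  -- Multiplies a polynomial by 1 + ε X; p is the coefficient preceding xs.
  mulBinomial : ℤ → ℤ → List ℤ → List ℤ
  mulBinomial ε p []       = [ ε * p ]
  mulBinomial ε p (x ∷ xs) = x + ε * p ∷ mulBinomial ε x xs

  mulBinomial-comm : ∀ ε δ p q xs →
    mulBinomial ε (p + δ * q) (mulBinomial δ p xs) ≡ mulBinomial δ (p + ε * q) (mulBinomial ε p xs)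
  mulBinomial-comm ε δ p q []       = cong₂ (λ u v → u ∷ [ v ]) (top ε δ p q) (last ε δ p)
    where
    top : ∀ ε δ p q → δ * p + ε * (p + δ * q) ≡ ε * p + δ * (p + ε * q)
    top = solve-∀
    last : ∀ ε δ p → ε * (δ * p) ≡ δ * (ε * p)
    last = solve-∀
  mulBinomial-comm ε δ p q (x ∷ xs) = cong₂ _∷_ (top ε δ p q x) (mulBinomial-comm ε δ x p xs)
    where
    top : ∀ ε δ p q x → x + δ * p + ε * (p + δ * q) ≡ x + ε * p + δ * (p + ε * q)
    top = solve-∀

  nth-mulBinomial-zero : ∀ ε p xs → nth 0ℤ (mulBinomial ε p xs) 0 ≡ nth 0ℤ xs 0 + ε * p
  nth-mulBinomial-zero ε p []       = sym (ℤ.+-identityˡ (ε * p))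
  nth-mulBinomial-zero ε p (x ∷ xs) = refl

  nth-mulBinomial-suc : ∀ ε p xs k → nth 0ℤ (mulBinomial ε p xs) (suc k) ≡ nth 0ℤ xs (suc k) + ε * nth 0ℤ xs k
  nth-mulBinomial-suc ε p []       k       = sym (trans (ℤ.+-identityˡ (ε * 0ℤ)) (ℤ.*-zeroʳ ε))
  nth-mulBinomial-suc ε p (x ∷ xs) zero    = nth-mulBinomial-zero ε x xs
  nth-mulBinomial-suc ε p (x ∷ xs) (suc k) = nth-mulBinomial-suc ε x xs k

  -- The coefficients of (1 − X)^t (1 + X)^(n − t).
  krawtchouk : ℕ → ℕ → List ℤ
  krawtchouk zero    t       = [ 1ℤ ]
  krawtchouk (suc n) zero    = mulBinomial 1ℤ 0ℤ (krawtchouk n 0)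
  krawtchouk (suc n) (suc t) = mulBinomial -1ℤ 0ℤ (krawtchouk n t)

  -- The recursion of `krawtchouk` strips the factors 1 - X first, whereas agreeing and differing
  -- coordinates of two words come in any order. Commuting the factors lets 1 + X be taken off first
  -- as well.
  krawtchouk-agree : ∀ {n t} → t ℕ.≤ n → krawtchouk (suc n) t ≡ mulBinomial 1ℤ 0ℤ (krawtchouk n t)
  krawtchouk-agree z≤n = refl
  krawtchouk-agree {suc n} {suc t} (s≤s t≤n) = trans (cong (mulBinomial -1ℤ 0ℤ) (krawtchouk-agree t≤n))
    (mulBinomial-comm -1ℤ 1ℤ 0ℤ 0ℤ (krawtchouk n t))

  hamming≤n : (x y : F₂^ n) → hamming x y ℕ.≤ n
  hamming≤n []          []          = z≤n
  hamming≤n (false ∷ x) (false ∷ y) = ℕ.m≤n⇒m≤1+n (hamming≤n x y)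
  hamming≤n (false ∷ x) (true  ∷ y) = s≤s (hamming≤n x y)
  hamming≤n (true  ∷ x) (false ∷ y) = s≤s (hamming≤n x y)
  hamming≤n (true  ∷ x) (true  ∷ y) = ℕ.m≤n⇒m≤1+n (hamming≤n x y)

  krawtchouk-∷ : ∀ a b (x y : F₂^ n) →
    krawtchouk (suc n) (hamming (a ∷ x) (b ∷ y)) ≡ mulBinomial (sgn a * sgn b) 0ℤ (krawtchouk n (hamming x y))
  krawtchouk-∷ false false x y = krawtchouk-agree (hamming≤n x y)
  krawtchouk-∷ false true  x y = refl
  krawtchouk-∷ true  false x y = refl
  krawtchouk-∷ true  true  x y = krawtchouk-agree (hamming≤n x y)

  -- Generating function: Σ_k K_k(x, y) X^k is the product of one factor per coordinate, 1 + X where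
  -- x and y agree and 1 - X where they differ.
  nth-krawtchouk : ∀ k (x y : F₂^ n) → nth 0ℤ (krawtchouk n (hamming x y)) k ≡ K k x y
  nth-krawtchouk zero    []      []      = refl
  nth-krawtchouk (suc k) []      []      = refl
  nth-krawtchouk {suc n} zero (a ∷ x) (b ∷ y)
    rewrite krawtchouk-∷ a b x y | nth-mulBinomial-zero (sgn a * sgn b) 0ℤ (krawtchouk n (hamming x y))
          | ℤ.*-zeroʳ (sgn a * sgn b) =
    trans (ℤ.+-identityʳ _) (nth-krawtchouk zero x y)
  nth-krawtchouk {suc n} (suc k) (a ∷ x) (b ∷ y)
    rewrite krawtchouk-∷ a b x y | nth-mulBinomial-suc (sgn a * sgn b) 0ℤ (krawtchouk n (hamming x y)) k =
    trans (cong₂ _+_ (nth-krawtchouk (suc k) x y) (cong (sgn a * sgn b *_) (nth-krawtchouk k x y))) (sym (K-suc k a b x y))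

  -- All distances t = 0, ..., n at once: each row is obtained from one row of the previous table,
  -- so that evaluation shares the work which separate calls of `krawtchouk` would repeat.
  krawtchoukTable : ℕ → List (List ℤ)
  krawtchoukTable zero    = [ [ 1ℤ ] ]
  krawtchoukTable (suc n) = mulBinomial 1ℤ 0ℤ (nth [] (krawtchoukTable n) 0) ∷ map (mulBinomial -1ℤ 0ℤ) (krawtchoukTable n)

  nth-map : ∀ (f : A → B) {z z′} xs {i} → i ℕ.< length xs → nth z′ (map f xs) i ≡ f (nth z xs i)
  nth-map f (x ∷ xs) {zero}  _         = refl
  nth-map f (x ∷ xs) {suc i} (s≤s i<l) = nth-map f xs i<l

  length-table : ∀ n → length (krawtchoukTable n) ≡ suc n
  length-table zero    = refl
  length-table (suc n) = cong suc (trans (length-map (mulBinomial -1ℤ 0ℤ) (krawtchoukTable n)) (length-table n))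

  nth-table : ∀ {n t} → t ℕ.≤ n → nth [] (krawtchoukTable n) t ≡ krawtchouk n t
  nth-table {zero}  z≤n = refl
  nth-table {suc n} z≤n = cong (mulBinomial 1ℤ 0ℤ) (nth-table {n} z≤n)
  nth-table {suc n} (s≤s t≤n) = trans
    (nth-map (mulBinomial -1ℤ 0ℤ) (krawtchoukTable n) (subst (_ ℕ.<_) (sym (length-table n)) (s≤s t≤n)))
    (cong (mulBinomial -1ℤ 0ℤ) (nth-table t≤n))

  -- Delsarte's linear programming bound

  -- The pairs (k , g) of a certificate stand for the positive definite function Σ g K_k.
  Certificate : Set
  Certificate = List (ℕ × ℕ)

  combination : Certificate → F₂^ n → F₂^ n → ℤ
  combination []            x y = 0ℤ
  combination ((k , g) ∷ c) x y = ℤ.+ g * K k x y + combination c x y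

  value : Certificate → List ℤ → ℤ
  value []            r = 0ℤ
  value ((k , g) ∷ c) r = ℤ.+ g * nth 0ℤ r k + value c r

  value-krawtchouk : ∀ c (x y : F₂^ n) → value c (krawtchouk n (hamming x y)) ≡ combination c x y
  value-krawtchouk []            x y = refl
  value-krawtchouk ((k , g) ∷ c) x y = cong₂ _+_ (cong (ℤ.+ g *_) (nth-krawtchouk k x y)) (value-krawtchouk c x y)

  quad-combination≥0 : ∀ W c → 0ℤ ℤ.≤ quad W (combination {n} c)
  quad-combination≥0 W []            = ℤ.≤-reflexive (sym (quad-zero W))
  quad-combination≥0 W ((k , g) ∷ c) = subst (0ℤ ℤ.≤_) (sym (quad-linear W (ℤ.+ g) (K k) (combination c)))
    (ℤ.+-mono-≤ (subst (ℤ._≤ ℤ.+ g * quad W (K k)) (ℤ.*-zeroʳ (ℤ.+ g)) (ℤ.*-monoˡ-≤-nonNeg (ℤ.+ g) (quad-K≥0 W k)))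
      (quad-combination≥0 W c))

  ∑-≤ : ∀ (xs : List A) {f u} → (∀ {x} → x ∈ xs → f x ℤ.≤ u) → ∑ xs f ℤ.≤ ℤ.+ length xs * u
  ∑-≤ []       {u = u} f≤u = ℤ.≤-refl
  ∑-≤ (x ∷ xs) {u = u} f≤u = ℤ.≤-trans (ℤ.+-mono-≤ (f≤u (here refl)) (∑-≤ xs (f≤u ∘ there)))
    (ℤ.≤-reflexive (sym (ℤ.suc-* (ℤ.+ length xs) u)))

  -- Adding u on the left stands in for the factor |xs| - 1 on the right and avoids a subtraction.
  ∑-isolate-≤ : ∀ {xs : List A} {f u x} → Unique xs → x ∈ xs → (∀ {y} → y ∈ xs → x ≢ y → f y ℤ.≤ u) →
    ∑ xs f + u ℤ.≤ f x + ℤ.+ length xs * u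
  ∑-isolate-≤ {xs = x ∷ xs} {f} {u} (x≢ ∷ _) (here refl) f≤u = begin
    f x + ∑ xs f + u               ≤⟨ ℤ.+-monoˡ-≤ u (ℤ.+-monoʳ-≤ (f x) (∑-≤ xs (λ y∈ → f≤u (there y∈) (All.lookup x≢ y∈)))) ⟩
    f x + ℤ.+ length xs * u + u    ≡⟨ regroup (f x) (ℤ.+ length xs) u ⟩
    f x + ℤ.+ suc (length xs) * u  ∎
    where
    open ℤ.≤-Reasoning
    regroup : ∀ a l u → a + l * u + u ≡ a + (1ℤ + l) * u
    regroup = solve-∀
  ∑-isolate-≤ {xs = y ∷ xs} {f} {u} {x} (y≢ ∷ xs!) (there x∈) f≤u = begin
    f y + ∑ xs f + u               ≡⟨ ℤ.+-assoc (f y) (∑ xs f) u ⟩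
    f y + (∑ xs f + u)             ≤⟨ ℤ.+-mono-≤ (f≤u (here refl) (All.lookup y≢ x∈ ∘ sym))
                                                 (∑-isolate-≤ xs! x∈ (f≤u ∘ there)) ⟩
    u + (f x + ℤ.+ length xs * u)  ≡⟨ regroup (f x) (ℤ.+ length xs) u ⟩
    f x + ℤ.+ suc (length xs) * u  ∎
    where
    open ℤ.≤-Reasoning
    regroup : ∀ a l u → u + (a + l * u) ≡ a + (1ℤ + l) * u
    regroup = solve-∀

  -- The sum of G over X × X is nonnegative. If |X| > M, every row of M G over X sums to at most M
  -- G(0) - M (1 + G(0)) = -M, so the total would be negative.
  delsarteBound : ∀ {M X} c → Unique X → 0 ℕ.< M →
    HasDistancesIn (λ t → value c (krawtchouk n 0) + ℤ.+ M * value c (krawtchouk n t) ℤ.< 0ℤ) X → length X ℕ.≤ M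
  delsarteBound {n} {M} {X} c X! M>0 dist = ℕ.≮⇒≥ λ M<X →
    ℤ.<⇒≱ (negative M<X) (subst (0ℤ ℤ.≤_) distribute
      (subst (ℤ._≤ ℤ.+ M * ∑ X (λ x → ∑ X (combination c x))) (ℤ.*-zeroʳ (ℤ.+ M)) (ℤ.*-monoˡ-≤-nonNeg (ℤ.+ M) nonNeg)))
    where
    distribute : ℤ.+ M * ∑ X (λ x → ∑ X (combination c x)) ≡ ∑ X (λ x → ∑ X (λ y → ℤ.+ M * combination c x y))
    distribute = trans (sym (∑-*ˡ X (ℤ.+ M) (λ x → ∑ X (combination c x))))
      (∑-cong X (λ {x} _ → sym (∑-*ˡ X (ℤ.+ M) (combination c x))))
    G₀ = value c (krawtchouk n 0)
    -- Over ℤ the strict hypothesis reads M G(d) ≤ -1 - G(0); this slack of 1 per entry is what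
    -- remains in the end.
    u  = - (1ℤ + G₀)
    nonNeg : 0ℤ ℤ.≤ ∑ X (λ x → ∑ X (combination c x))
    nonNeg = subst (0ℤ ℤ.≤_) (trans (unweight _) (∑-cong X (λ {x} _ → unweight (combination c x))))
      (quad-combination≥0 (map (1ℤ ,_) X) c)
      where
      unweight : ∀ (φ : F₂^ n → ℤ) → moment (map (1ℤ ,_) X) φ ≡ ∑ X φ
      unweight φ = trans (∑-map (1ℤ ,_) X (λ w → proj₁ w * φ (proj₂ w))) (∑-cong X (λ {x} _ → ℤ.*-identityˡ (φ x)))
    diagonal : (x : F₂^ n) → combination c x x ≡ G₀
    diagonal x = trans (sym (value-krawtchouk c x x)) (cong (λ t → value c (krawtchouk n t)) (hamming-self x))
    G₀≥0 : 0ℤ ℤ.≤ G₀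
    -- G(0) is the quadratic form of a single point; any word would do.
    G₀≥0 = subst (0ℤ ℤ.≤_) (trans (single (combination c o o)) (diagonal o)) (quad-combination≥0 [ 1ℤ , o ] c)
      where
      o = replicate n false
      single : ∀ i → 1ℤ * (1ℤ * i + 0ℤ) + 0ℤ ≡ i
      single = solve-∀
    -- This sign allows the number m ≥ M of off-diagonal entries in a row to be replaced by M.
    u≤0 : u ℤ.≤ 0ℤ
    u≤0 = ℤ.neg-mono-≤ (ℤ.≤-trans G₀≥0 (ℤ.i≤suc[i] G₀))
    rowBound : ∀ {m x} → length X ≡ suc m → M ℕ.≤ m → x ∈ X → ∑ X (λ y → ℤ.+ M * combination c x y) ℤ.≤ -1ℤ
    rowBound {m} {x} X≡ M≤m x∈ = begin
      ∑ X h                                          ≡⟨ addSub (∑ X h) u ⟩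
      ∑ X h + u - u                                  ≤⟨ ℤ.+-monoˡ-≤ (- u) (∑-isolate-≤ X! x∈ offDiagonal) ⟩
      h x + ℤ.+ length X * u - u                     ≡⟨ cong₂ (λ i l → ℤ.+ M * i + ℤ.+ l * u - u) (diagonal x) X≡ ⟩
      ℤ.+ M * G₀ + (1ℤ + ℤ.+ m) * u - u              ≡⟨ cancel (ℤ.+ M * G₀) (ℤ.+ m) u ⟩
      ℤ.+ M * G₀ + ℤ.+ m * u                         ≤⟨ ℤ.+-monoʳ-≤ (ℤ.+ M * G₀)
                                                          (ℤ.*-monoʳ-≤-nonPos u {{ℤ.nonPositive u≤0}} (ℤ.+≤+ M≤m)) ⟩
      ℤ.+ M * G₀ + ℤ.+ M * u                         ≡⟨ collect (ℤ.+ M) G₀ ⟩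
      - ℤ.+ M                                        ≤⟨ ℤ.neg-mono-≤ (ℤ.+≤+ M>0) ⟩
      -1ℤ ∎
      where
      open ℤ.≤-Reasoning
      h : F₂^ n → ℤ
      h y = ℤ.+ M * combination c x y
      addSub : ∀ i j → i ≡ i + j - j
      addSub = solve-∀
      cancel : ∀ i l j → i + (1ℤ + l) * j - j ≡ i + l * j
      cancel = solve-∀
      collect : ∀ l i → l * i + l * - (1ℤ + i) ≡ - l
      collect = solve-∀
      offDiagonal : ∀ {y} → y ∈ X → x ≢ y → h y ℤ.≤ u
      offDiagonal {y} y∈ x≢y = begin
        h y                          ≡⟨ cong (ℤ.+ M *_) (sym (value-krawtchouk c x y)) ⟩
        ℤ.+ M * v                    ≡⟨ isolate G₀ (ℤ.+ M * v) ⟩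
        ℤ.suc (G₀ + ℤ.+ M * v) + u   ≤⟨ ℤ.+-monoˡ-≤ u (ℤ.i<j⇒suc[i]≤j (dist x∈ y∈ x≢y)) ⟩
        0ℤ + u                       ≡⟨ ℤ.+-identityˡ u ⟩
        u ∎
        where
        v = value c (krawtchouk n (hamming x y))
        isolate : ∀ i j → j ≡ 1ℤ + (i + j) + - (1ℤ + i)
        isolate = solve-∀
    negative : M ℕ.< length X → ∑ X (λ x → ∑ X (λ y → ℤ.+ M * combination c x y)) ℤ.< 0ℤ
    negative M<X with length X in X≡
    ... | suc m = ℤ.≤-<-trans (∑-≤ X (rowBound X≡ (ℕ.s≤s⁻¹ M<X))) (subst (λ l → ℤ.+ l * -1ℤ ℤ.< 0ℤ) (sym X≡) ℤ.-<+)

  -- Enumeration of the distance sets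

  subsets : ℕ → ℕ → List (List ℕ)
  subsets zero    m       = [ [] ]
  subsets (suc s) zero    = []
  subsets (suc s) (suc m) = map (suc m ∷_) (subsets s m) ++ subsets (suc s) m

  exclude-top : ∀ {m e} → 0 ℕ.< e × e ℕ.≤ suc m → suc m ≢ e → 0 ℕ.< e × e ℕ.≤ m
  exclude-top (e>0 , e≤) ≢e = e>0 , ℕ.s≤s⁻¹ (ℕ.≤∧≢⇒< e≤ (≢e ∘ sym))

  -- A distance set comes in arbitrary order, whereas the enumeration lists decreasing sequences;
  -- the recursion moves the largest admissible value, when present, to the front.
  subsets-complete : ∀ m {D} → Unique D → All (λ d → 0 ℕ.< d × d ℕ.≤ m) D → ∃ λ L → L ∈ subsets (length D) m × D ↭ L
  subsets-complete m {[]} D! bounds = [] , here refl , ↭-refl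
  subsets-complete zero {d ∷ D} D! ((d>0 , d≤0) ∷ _) = contradiction (ℕ.<-≤-trans d>0 d≤0) (λ ())
  subsets-complete (suc m) {D@(_ ∷ D₀)} D! bounds with suc m ∈? D
  ... | no ∉D =
    let L , L∈ , D↭L = subsets-complete m D! (All.tabulate λ e∈ → exclude-top (All.lookup bounds e∈) λ { refl → ∉D e∈ })
    in L , ∈-++⁺ʳ (map (suc m ∷_) (subsets (length D₀) m)) L∈ , D↭L
  ... | yes ∈D with ∈-∃++ ∈D
  ... | ys , zs , D≡ with D↭ ← ↭-trans (subst (D ↭_) D≡ ↭-refl) (shift (suc m) ys zs)
                     with ≢E ∷ E! ← Permutation.Unique-resp-↭ (setoid ℕ) (↭⇒↭ₛ D↭) D!
                     with _ ∷ boundsE ← All-resp-↭ D↭ bounds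
                     with L , L∈ , E↭L ← subsets-complete m E! (All.zipWith (λ (≢e , b) → exclude-top b ≢e) (≢E , boundsE)) =
    suc m ∷ L ,
    ∈-++⁺ˡ (∈-map⁺ (suc m ∷_) (subst (λ l → L ∈ subsets l m) (ℕ.suc-injective (sym (↭-length D↭))) L∈)) ,
    ↭-trans D↭ (prep (suc m) E↭L)

  picks : List ℕ → List (ℕ × List ℕ)
  picks []      = []
  picks (d ∷ D) = (d , D) ∷ map (λ p → proj₁ p , d ∷ proj₂ p) (picks D)

  picks-length : ∀ D {p} → p ∈ picks D → suc (length (proj₂ p)) ≡ length D
  picks-length (d ∷ D) (here refl) = refl
  picks-length (d ∷ D) (there p∈) with ∈-map⁻ (λ p → proj₁ p , d ∷ proj₂ p) p∈
  ... | q , q∈ , refl = cong suc (picks-length D q∈)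

  picks-∈ : ∀ D {p t} → p ∈ picks D → t ∈ D → t ≡ proj₁ p ⊎ t ∈ proj₂ p
  picks-∈ (d ∷ D) (here refl) (here refl) = inj₁ refl
  picks-∈ (d ∷ D) (here refl) (there t∈)  = inj₂ t∈
  picks-∈ (d ∷ D) (there p∈) t∈ with ∈-map⁻ (λ p → proj₁ p , d ∷ proj₂ p) p∈ | t∈
  ... | q , q∈ , refl | here refl = inj₂ (here refl)
  ... | q , q∈ , refl | there t∈D with picks-∈ D q∈ t∈D
  ...   | inj₁ t≡ = inj₁ t≡
  ...   | inj₂ t∈′ = inj₂ (there t∈′)

  -- Both sides contain the factor 2 exactly |D′| times, so this is the condition that Π (e - d)
  -- divides Π e.
  Divisible : ℕ × List ℕ → Set
  Divisible (d , D′) = ∣ annih D′ d ∣ ℕ.∣ ∣ annih D′ 0 ∣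

  divisible? : ∀ p → Dec (Divisible p)
  divisible? (d , D′) = ∣ annih D′ d ∣ ℕ.∣? ∣ annih D′ 0 ∣

  Integral : List ℕ → Set
  Integral D = All Divisible (picks D)

  integral? : ∀ D → Dec (Integral D)
  integral? D = All.all? divisible? (picks D)

  ¬integral⇒bound : ∀ {D} {X : List (F₂^ n)} → Unique X → HasDistancesIn (_∈ D) X → ¬ Integral D →
    length X ℕ.≤ dim n (range 0 (length D))
  ¬integral⇒bound {n} {D} {X} X! dist ¬int
    with p , p∈ , b∤a ← find (All.¬All⇒Any¬ divisible? (picks D) ¬int) =
    subst (λ l → length X ℕ.≤ dim n (range 0 l)) (picks-length D p∈)
      (integralityBound X! (λ x∈ y∈ x≢y → picks-∈ D p∈ (dist x∈ y∈ x≢y)) b∤a)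

  -- The finite verification

  -- Entry t tells whether the distance t satisfies the hypothesis of delsarteBound.
  covers : ℕ → List (List ℤ) → Certificate → List Bool
  covers M rows c = go (value c (nth [] rows 0))
    where
    go : ℤ → List Bool
    go G₀ = map (λ r → G₀ + ℤ.+ M * value c r ≤ᵇ -1ℤ) rows

  -- Whether a certificate handles a distance does not depend on the rest of D. One table per
  -- length, passed on as an argument, therefore serves all distance sets.
  coverTable : ℕ → List (List ℤ) → List Certificate → List (List Bool)
  coverTable M rows = map (covers M rows)

  -- A set with a distance above n cannot occur in length n and passes at once. Otherwise the sign
  -- bound must suffice, or a single certificate must cover all of D; the default `false` makes an
  -- entry outside the table count as not covered.
  verify : ℕ → ℕ → List (List Bool) → List ℕ → Bool
  verify n M cs D = not (all (ℕ._≤ᵇ n) D) ∨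
    ((dim n (positives 0 (annihCoeffs n D)) ℕ.≤ᵇ M) ∨ any (λ c → all (nth false c) D) cs)

  verifyAll : ℕ → ℕ → List (List Bool) → List (List ℕ) → Bool
  verifyAll n M cs = all (verify n M cs)

  -- The first conjunct brings the integrality bound below the target, which settles every D that
  -- fails a divisibility condition; the second gives the M > 0 of `delsarteBound`.
  check : ℕ → (ℕ → ℕ) → List (List ℕ) → List (ℕ × List Certificate) → Bool
  check s M Ds = all λ { (n , cs) → (dim n (range 0 s) ℕ.≤ᵇ M n) ∧ ((1 ℕ.≤ᵇ M n) ∧
    verifyAll n (M n) (coverTable (M n) (krawtchoukTable n) cs) Ds) }

  nth-map-T : ∀ (p : A → Bool) {z} xs i → T (nth false (map p xs) i) → T (p (nth z xs i))
  nth-map-T p (x ∷ xs) zero    t = t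
  nth-map-T p (x ∷ xs) (suc i) t = nth-map-T p xs i t

  covers-sound : ∀ {n M t} c → t ℕ.≤ n → T (nth false (covers M (krawtchoukTable n) c) t) →
    value c (krawtchouk n 0) + ℤ.+ M * value c (krawtchouk n t) ℤ.< 0ℤ
  covers-sound {n} {M} {t} c t≤n ok = ℤ.≤-<-trans
    (ℤ.≤ᵇ⇒≤ (subst₂ (λ r₀ r → T (value c r₀ + ℤ.+ M * value c r ≤ᵇ -1ℤ)) (nth-table {n} z≤n) (nth-table t≤n)
      (nth-map-T (λ r → value c (nth [] (krawtchoukTable n) 0) + ℤ.+ M * value c r ≤ᵇ -1ℤ) (krawtchoukTable n) t ok))) ℤ.-<+

  verify-sound : ∀ {n M D cs} {X : List (F₂^ n)} →
    Unique X → All (λ d → 0 ℕ.< d × d ℕ.≤ n) D → HasDistancesIn (_∈ D) X → 0 ℕ.< M →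
    T (verify n M (map (covers M (krawtchoukTable n)) cs) D) → length X ℕ.≤ M
  verify-sound {n} {M} {D} {cs} {X} X! bounds dist M>0 ok with all (ℕ._≤ᵇ n) D in inRange
  ... | false = contradiction (All.all⁻ (ℕ._≤ᵇ n) (All.map (ℕ.≤⇒≤ᵇ ∘ proj₂) bounds)) (subst T inRange)
  ... | true with to T-∨ ok
  ...   | inj₁ small = ℕ.≤-trans (signBound X! (All.map proj₁ bounds) dist) (ℕ.≤ᵇ⇒≤ _ M small)
  ...   | inj₂ covered
    with find (Any.map⁻ (Any.any⁻ (λ c → all (nth false c) D) (map (covers M (krawtchoukTable n)) cs) covered))
  ...     | c , _ , ok′ = delsarteBound c X! M>0 λ x∈ y∈ x≢y →
    let t∈D = dist x∈ y∈ x≢y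
    in covers-sound {n} {M} c (proj₂ (All.lookup bounds t∈D))
         (All.lookup (All.all⁺ (nth false (covers M (krawtchoukTable n) c)) D ok′) t∈D)

  hamming≡0⇒≡ : (x y : F₂^ n) → hamming x y ≡ 0 → x ≡ y
  hamming≡0⇒≡ []          []          _  = refl
  hamming≡0⇒≡ (false ∷ x) (false ∷ y) eq = cong (false ∷_) (hamming≡0⇒≡ x y eq)
  hamming≡0⇒≡ (true  ∷ x) (true  ∷ y) eq = cong (true ∷_) (hamming≡0⇒≡ x y eq)

  distances-bounded : ∀ {X : List (F₂^ n)} {D} → (∀ d → d ∈ D ⇔ IsDistanceOf X d) → All (λ d → 0 ℕ.< d × d ℕ.≤ n) D
  distances-bounded D⇔ = All.tabulate λ {d} d∈ → case to (D⇔ d) d∈ of λ where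
    (x , y , _ , _ , x≢y , refl) → ℕ.n≢0⇒n>0 (x≢y ∘ hamming≡0⇒≡ x y) , hamming≤n x y

  check-sound : ∀ {n m} s M entries → n ℕ.≤ m → check s M (filter integral? (subsets s m)) entries ≡ true →
    n ∈ map proj₁ entries → ∀ X → IsSDistanceSet n s X → length X ℕ.≤ M n
  check-sound {n} {m} s M entries n≤m ok n∈ X (X! , D , D! , refl , D⇔)
    with (.n , cs) , entry , refl ← ∈-map⁻ proj₁ n∈
    with low , ok′ ← to T-∧ (All.lookup (All.all⁺ _ entries (subst T (sym ok) tt)) entry)
    with pos , verified ← to T-∧ ok′
    with L , L∈ , D↭L ← subsets-complete m D! (All.map (λ (d>0 , d≤n) → d>0 , ℕ.≤-trans d≤n n≤m) (distances-bounded D⇔))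
    with dist ← (λ {x} {y} x∈ y∈ x≢y → ∈-resp-↭ D↭L (from (D⇔ (hamming x y)) (x , y , x∈ , y∈ , x≢y , refl)))
    with integral? L
  ... | no ¬int = ℕ.≤-trans
    (subst (λ l → length X ℕ.≤ dim n (range 0 l)) (sym (↭-length D↭L)) (¬integral⇒bound X! dist ¬int))
    (ℕ.≤ᵇ⇒≤ _ (M n) low)
  ... | yes int = verify-sound {cs = cs} X! (All-resp-↭ D↭L (distances-bounded D⇔)) dist
    (ℕ.≤ᵇ⇒≤ 1 (M n) pos) (All.lookup (All.all⁺ _ _ verified) (∈-filter⁺ integral? L∈ int))

open Bounds
open import Data.Nat using (_+_)

-- For each length, linear programming certificates that cover all the distance sets left open by the other two bounds.

certificates₃ : List (ℕ × List Certificate)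
certificates₃ =
  (8 , ((1 , 5) ∷ (2 , 1) ∷ []) ∷ ((1 , 1) ∷ (8 , 3) ∷ []) ∷ ((6 , 1) ∷ (7 , 2) ∷ []) ∷
    ((1 , 13) ∷ (3 , 13) ∷ (4 , 10) ∷ []) ∷ []) ∷
  (9 , ((1 , 1) ∷ []) ∷ ((2 , 1) ∷ (8 , 3) ∷ []) ∷ ((4 , 1) ∷ (7 , 5) ∷ []) ∷ ((2 , 2) ∷ (3 , 1) ∷ []) ∷
    ((1 , 2) ∷ (3 , 1) ∷ (4 , 1) ∷ []) ∷ []) ∷
  (10 , ((1 , 5) ∷ (2 , 1) ∷ []) ∷ ((1 , 7) ∷ (2 , 3) ∷ (3 , 2) ∷ []) ∷ ((8 , 1) ∷ []) ∷ ((1 , 2) ∷ (4 , 1) ∷ []) ∷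
    ((2 , 1) ∷ (3 , 2) ∷ []) ∷ []) ∷
  (11 , ((1 , 10) ∷ (2 , 3) ∷ (3 , 3) ∷ []) ∷ ((1 , 1) ∷ []) ∷ ((2 , 1) ∷ []) ∷ ((6 , 1) ∷ (10 , 5) ∷ []) ∷ []) ∷
  (12 , ((1 , 10) ∷ (2 , 1) ∷ []) ∷ ((3 , 1) ∷ (10 , 1) ∷ []) ∷ ((2 , 1) ∷ (7 , 1) ∷ []) ∷
    ((2 , 3) ∷ (3 , 1) ∷ []) ∷ ((4 , 1) ∷ (5 , 1) ∷ []) ∷ []) ∷
  (13 , ((1 , 5) ∷ (2 , 1) ∷ []) ∷ ((7 , 1) ∷ (10 , 5) ∷ []) ∷ ((8 , 1) ∷ []) ∷ ((3 , 1) ∷ []) ∷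
    ((2 , 2) ∷ (3 , 1) ∷ []) ∷ []) ∷
  (14 , ((1 , 10) ∷ (2 , 1) ∷ []) ∷ ((4 , 1) ∷ (12 , 3) ∷ []) ∷ ((10 , 1) ∷ (11 , 2) ∷ []) ∷
    ((6 , 1) ∷ (9 , 5) ∷ []) ∷ ((2 , 3) ∷ (3 , 1) ∷ []) ∷ ((2 , 1) ∷ (6 , 1) ∷ []) ∷ []) ∷
  (15 , ((1 , 1) ∷ []) ∷ ((11 , 1) ∷ (12 , 1) ∷ []) ∷ ((2 , 5) ∷ (11 , 1) ∷ []) ∷ ((3 , 1) ∷ []) ∷ ((6 , 1) ∷ []) ∷
    ((2 , 2) ∷ (3 , 1) ∷ []) ∷ ((3 , 3) ∷ (6 , 1) ∷ []) ∷ ((4 , 1) ∷ (5 , 1) ∷ []) ∷ []) ∷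
  (16 , ((1 , 10) ∷ (2 , 1) ∷ []) ∷ ((12 , 1) ∷ []) ∷ ((2 , 1) ∷ (3 , 2) ∷ []) ∷ ((4 , 5) ∷ (7 , 1) ∷ []) ∷
    ((5 , 1) ∷ []) ∷ ((2 , 3) ∷ (3 , 1) ∷ []) ∷ []) ∷
  (17 , ((1 , 1) ∷ []) ∷ ((4 , 1) ∷ (14 , 5) ∷ []) ∷ ((12 , 1) ∷ (13 , 2) ∷ []) ∷ ((15 , 1) ∷ (16 , 5) ∷ []) ∷
    ((2 , 5) ∷ (5 , 1) ∷ []) ∷ []) ∷
  (18 , ((1 , 10) ∷ (2 , 1) ∷ []) ∷ ((3 , 3) ∷ (14 , 1) ∷ []) ∷ ((4 , 1) ∷ (16 , 5) ∷ []) ∷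
    ((4 , 1) ∷ (5 , 1) ∷ []) ∷ ((2 , 10) ∷ (5 , 1) ∷ []) ∷ []) ∷
  (19 , ((1 , 1) ∷ []) ∷ ((14 , 1) ∷ []) ∷ ((12 , 1) ∷ (15 , 5) ∷ []) ∷ ((4 , 1) ∷ (17 , 5) ∷ []) ∷
    ((2 , 20) ∷ (5 , 1) ∷ []) ∷ ((8 , 1) ∷ []) ∷ []) ∷
  (20 , ((1 , 10) ∷ (2 , 1) ∷ []) ∷ ((14 , 1) ∷ (15 , 3) ∷ []) ∷ ((2 , 1) ∷ (3 , 5) ∷ []) ∷
    ((2 , 100) ∷ (7 , 1) ∷ []) ∷ ((4 , 1) ∷ []) ∷ ((8 , 1) ∷ []) ∷ ((6 , 1) ∷ (7 , 1) ∷ []) ∷ []) ∷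
  (21 , ((1 , 1) ∷ []) ∷ ((15 , 1) ∷ (16 , 1) ∷ []) ∷ ((16 , 1) ∷ (17 , 2) ∷ []) ∷ ((1 , 5) ∷ (18 , 1) ∷ []) ∷
    ((1 , 3) ∷ (2 , 1) ∷ []) ∷ ((3 , 3) ∷ (5 , 1) ∷ []) ∷ ((2 , 2) ∷ (3 , 1) ∷ []) ∷ ((3 , 5) ∷ (4 , 1) ∷ []) ∷ []) ∷
  (22 , ((1 , 20) ∷ (2 , 1) ∷ []) ∷ ((16 , 1) ∷ []) ∷ ((17 , 2) ∷ (18 , 1) ∷ []) ∷ ((6 , 1) ∷ (7 , 1) ∷ []) ∷
    ((2 , 3) ∷ (3 , 1) ∷ []) ∷ ((1 , 2) ∷ (20 , 1) ∷ []) ∷ ((9 , 1) ∷ []) ∷ []) ∷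
  (24 , ((1 , 20) ∷ (2 , 1) ∷ []) ∷ ((5 , 2) ∷ (18 , 1) ∷ []) ∷ ((2 , 3) ∷ (21 , 1) ∷ []) ∷
    ((3 , 10) ∷ (4 , 1) ∷ []) ∷ ((4 , 10) ∷ (7 , 1) ∷ []) ∷ ((2 , 50) ∷ (5 , 1) ∷ []) ∷ ((1 , 3) ∷ (2 , 1) ∷ []) ∷
    ((6 , 2) ∷ (7 , 1) ∷ []) ∷ ((2 , 20) ∷ (7 , 1) ∷ []) ∷ []) ∷
  (25 , ((1 , 10) ∷ (3 , 1) ∷ []) ∷ ((18 , 1) ∷ (22 , 2) ∷ []) ∷ ((1 , 10) ∷ (2 , 1) ∷ []) ∷
    ((5 , 1) ∷ (22 , 10) ∷ []) ∷ ((5 , 1) ∷ (24 , 10) ∷ []) ∷ ((2 , 2) ∷ (3 , 1) ∷ []) ∷ ((2 , 5) ∷ (3 , 1) ∷ []) ∷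
    []) ∷
  (26 , ((1 , 20) ∷ (2 , 1) ∷ []) ∷ ((20 , 1) ∷ []) ∷ ((2 , 10) ∷ (22 , 1) ∷ []) ∷ ((23 , 1) ∷ (24 , 3) ∷ []) ∷
    ((23 , 1) ∷ (25 , 10) ∷ []) ∷ ((7 , 1) ∷ (22 , 5) ∷ []) ∷ ((5 , 1) ∷ []) ∷ []) ∷
  (27 , ((1 , 36) ∷ (2 , 9) ∷ (3 , 4) ∷ []) ∷ ((4 , 1) ∷ (5 , 2) ∷ []) ∷ ((3 , 10) ∷ (4 , 1) ∷ []) ∷
    ((6 , 2) ∷ (20 , 1) ∷ []) ∷ ((4 , 1) ∷ []) ∷ ((7 , 1) ∷ []) ∷ ((8 , 1) ∷ []) ∷ ((24 , 1) ∷ []) ∷ []) ∷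
  (28 , ((1 , 20) ∷ (2 , 1) ∷ []) ∷ ((1 , 45) ∷ (2 , 7) ∷ (3 , 5) ∷ []) ∷ ((5 , 1) ∷ (24 , 2) ∷ []) ∷
    ((1 , 46) ∷ (2 , 17) ∷ (3 , 4) ∷ []) ∷ ((2 , 1) ∷ (3 , 1) ∷ []) ∷ ((6 , 1) ∷ (21 , 2) ∷ []) ∷ ((5 , 1) ∷ []) ∷
    ((25 , 1) ∷ []) ∷ ((2 , 1) ∷ (4 , 1) ∷ []) ∷ []) ∷
  (29 , ((1 , 1) ∷ []) ∷ ((2 , 5) ∷ (22 , 1) ∷ []) ∷ ((1 , 50) ∷ (2 , 19) ∷ (3 , 6) ∷ []) ∷
    ((1 , 2) ∷ (5 , 1) ∷ []) ∷ ((26 , 1) ∷ []) ∷ ((2 , 10) ∷ (4 , 1) ∷ []) ∷ ((4 , 1) ∷ (24 , 10) ∷ []) ∷ []) ∷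
  (30 , ((1 , 20) ∷ (2 , 1) ∷ []) ∷ ((1 , 6) ∷ (2 , 2) ∷ (3 , 1) ∷ []) ∷ ((2 , 5) ∷ (22 , 1) ∷ []) ∷
    ((2 , 10) ∷ (4 , 1) ∷ []) ∷ ((2 , 3) ∷ (5 , 1) ∷ []) ∷ ((1 , 100) ∷ (7 , 1) ∷ []) ∷ ((3 , 5) ∷ (4 , 1) ∷ []) ∷
    ((4 , 3) ∷ (5 , 1) ∷ []) ∷ []) ∷
  (31 , ((1 , 1) ∷ (31 , 2) ∷ []) ∷ ((1 , 10) ∷ (2 , 2) ∷ (3 , 2) ∷ []) ∷ ((1 , 3) ∷ (2 , 1) ∷ []) ∷
    ((23 , 1) ∷ (27 , 5) ∷ []) ∷ ((5 , 1) ∷ []) ∷ ((26 , 1) ∷ (27 , 3) ∷ []) ∷ ((30 , 1) ∷ []) ∷ ((7 , 1) ∷ []) ∷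
    ((3 , 3) ∷ (4 , 1) ∷ []) ∷ []) ∷
  (32 , ((1 , 1) ∷ (32 , 3) ∷ []) ∷ ((2 , 1) ∷ (3 , 5) ∷ []) ∷ ((1 , 5) ∷ (2 , 1) ∷ []) ∷
    ((4 , 3) ∷ (5 , 1) ∷ []) ∷ ((7 , 1) ∷ []) ∷ ((3 , 3) ∷ (4 , 1) ∷ []) ∷ ((5 , 5) ∷ (6 , 1) ∷ []) ∷
    ((2 , 2) ∷ (28 , 1) ∷ []) ∷ ((5 , 1) ∷ []) ∷ ((4 , 5) ∷ (8 , 1) ∷ []) ∷ ((1 , 10) ∷ (2 , 1) ∷ []) ∷
    ((2 , 50) ∷ (5 , 1) ∷ []) ∷ []) ∷
  (33 , ((1 , 1) ∷ []) ∷ ((1 , 10) ∷ (3 , 1) ∷ []) ∷ ((28 , 1) ∷ (29 , 3) ∷ []) ∷ ((3 , 3) ∷ (28 , 1) ∷ []) ∷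
    ((2 , 10) ∷ (4 , 1) ∷ []) ∷ ((31 , 1) ∷ (32 , 10) ∷ []) ∷ ((3 , 1) ∷ []) ∷ ((2 , 5) ∷ (3 , 1) ∷ []) ∷
    ((4 , 5) ∷ (6 , 1) ∷ []) ∷ ((5 , 1) ∷ []) ∷ ((3 , 2) ∷ (4 , 1) ∷ []) ∷ ((6 , 2) ∷ (7 , 1) ∷ []) ∷
    ((5 , 10) ∷ (8 , 1) ∷ []) ∷ []) ∷
  (36 , ((1 , 20) ∷ (2 , 1) ∷ []) ∷ ((2 , 1) ∷ (3 , 5) ∷ []) ∷ ((4 , 5) ∷ (5 , 1) ∷ []) ∷
    ((4 , 1) ∷ (5 , 2) ∷ []) ∷ ((1 , 38) ∷ (2 , 10) ∷ (3 , 3) ∷ []) ∷ ((31 , 1) ∷ (33 , 10) ∷ []) ∷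
    ((2 , 3) ∷ (31 , 1) ∷ []) ∷ ((7 , 1) ∷ []) ∷ ((1 , 2) ∷ (2 , 1) ∷ []) ∷ ((8 , 1) ∷ (9 , 1) ∷ []) ∷ []) ∷
  (37 , ((1 , 1) ∷ []) ∷ ((3 , 10) ∷ (4 , 1) ∷ []) ∷ ((4 , 3) ∷ (5 , 1) ∷ []) ∷ ((1 , 10) ∷ (2 , 1) ∷ []) ∷
    ((2 , 5) ∷ (34 , 1) ∷ []) ∷ ((5 , 10) ∷ (6 , 1) ∷ []) ∷ ((33 , 1) ∷ (34 , 1) ∷ []) ∷ ((3 , 1) ∷ (32 , 1) ∷ []) ∷
    ((2 , 10) ∷ (33 , 1) ∷ []) ∷ ((1 , 3000) ∷ (9 , 1) ∷ []) ∷ ((3 , 21) ∷ (4 , 9) ∷ (5 , 2) ∷ []) ∷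
    ((1 , 43) ∷ (2 , 11) ∷ (3 , 4) ∷ []) ∷ ((2 , 4110) ∷ (5 , 188) ∷ (6 , 67) ∷ []) ∷ []) ∷
  (44 , ((1 , 34) ∷ (2 , 7) ∷ (3 , 2) ∷ []) ∷ ((4 , 1) ∷ (41 , 10) ∷ []) ∷ ((5 , 1) ∷ (40 , 3) ∷ []) ∷
    ((3 , 1) ∷ (42 , 2) ∷ []) ∷ ((7 , 1) ∷ []) ∷ ((5 , 2) ∷ (38 , 1) ∷ []) ∷ ((1 , 49) ∷ (2 , 2) ∷ (4 , 2) ∷ []) ∷
    ((5 , 10) ∷ (7 , 1) ∷ []) ∷ ((9 , 1) ∷ []) ∷ ((42 , 1) ∷ []) ∷ ((5 , 171) ∷ (6 , 66) ∷ (7 , 5) ∷ []) ∷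
    ((8 , 1) ∷ (36 , 1) ∷ (44 , 100000) ∷ []) ∷ []) ∷
  []

certificates₄ : List (ℕ × List Certificate)
certificates₄ =
  (10 , ((1 , 7) ∷ (2 , 3) ∷ (3 , 2) ∷ []) ∷ ((1 , 1) ∷ (10 , 5) ∷ []) ∷ ((2 , 1) ∷ (3 , 2) ∷ []) ∷
    ((2 , 1) ∷ (9 , 3) ∷ []) ∷ []) ∷
  (11 , ((1 , 10) ∷ (2 , 3) ∷ (3 , 3) ∷ (8 , 1) ∷ []) ∷ ((1 , 2) ∷ (10 , 2) ∷ (11 , 10) ∷ []) ∷ []) ∷
  (12 , ((1 , 10) ∷ (2 , 4) ∷ (3 , 3) ∷ (4 , 1) ∷ []) ∷ ((1 , 10) ∷ (2 , 1) ∷ []) ∷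
    ((1 , 7) ∷ (2 , 4) ∷ (3 , 2) ∷ (4 , 1) ∷ []) ∷ ((11 , 1) ∷ (12 , 3) ∷ []) ∷ ((2 , 3) ∷ (3 , 1) ∷ []) ∷
    ((2 , 2) ∷ (4 , 1) ∷ []) ∷ ((3 , 1) ∷ (10 , 1) ∷ []) ∷ ((1 , 25) ∷ (5 , 4) ∷ (6 , 1) ∷ []) ∷ []) ∷
  (13 , ((1 , 5) ∷ (2 , 1) ∷ []) ∷ ((1 , 5) ∷ (2 , 5) ∷ (3 , 2) ∷ (4 , 2) ∷ []) ∷ ((1 , 1) ∷ []) ∷
    ((2 , 1) ∷ (12 , 5) ∷ []) ∷ ((10 , 1) ∷ []) ∷ ((8 , 1) ∷ []) ∷ ((2 , 3) ∷ (4 , 1) ∷ []) ∷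
    ((1 , 26) ∷ (5 , 2) ∷ (6 , 2) ∷ []) ∷ ((1 , 16) ∷ (3 , 3) ∷ (4 , 5) ∷ (5 , 3) ∷ []) ∷
    ((2 , 34) ∷ (3 , 10) ∷ (4 , 5) ∷ (5 , 6) ∷ []) ∷ []) ∷
  (14 , ((1 , 6) ∷ (2 , 2) ∷ (3 , 1) ∷ []) ∷ ((4 , 1) ∷ (12 , 3) ∷ []) ∷
    ((2 , 25) ∷ (3 , 14) ∷ (4 , 3) ∷ (5 , 6) ∷ []) ∷ ((1 , 1) ∷ (14 , 5) ∷ []) ∷ ((10 , 1) ∷ (11 , 2) ∷ []) ∷
    ((1 , 5) ∷ (6 , 1) ∷ []) ∷ ((2 , 5) ∷ (4 , 1) ∷ []) ∷ ((1 , 21) ∷ (3 , 1) ∷ (4 , 3) ∷ (5 , 3) ∷ []) ∷ []) ∷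
  (15 , ((1 , 10) ∷ (2 , 2) ∷ (3 , 2) ∷ []) ∷ ((2 , 124) ∷ (3 , 171) ∷ (5 , 55) ∷ (6 , 5) ∷ []) ∷
    ((4 , 1) ∷ (5 , 2) ∷ []) ∷ ((14 , 1) ∷ []) ∷ ((1 , 3) ∷ (9 , 1) ∷ []) ∷ ((3 , 5) ∷ (4 , 1) ∷ []) ∷
    ((3 , 2) ∷ (5 , 1) ∷ []) ∷ ((1 , 43) ∷ (6 , 2) ∷ (7 , 1) ∷ []) ∷ ((1 , 25) ∷ (4 , 1) ∷ (5 , 3) ∷ (6 , 1) ∷ []) ∷
    []) ∷
  (16 , ((1 , 100) ∷ (2 , 30) ∷ (3 , 20) ∷ (4 , 5) ∷ []) ∷ ((3 , 15) ∷ (5 , 3) ∷ (6 , 2) ∷ []) ∷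
    ((5 , 1) ∷ (14 , 5) ∷ []) ∷ ((1 , 10) ∷ (10 , 1) ∷ []) ∷ ((15 , 1) ∷ []) ∷
    ((1 , 31) ∷ (2 , 2) ∷ (5 , 2) ∷ (6 , 2) ∷ []) ∷ []) ∷
  (17 , ((1 , 524) ∷ (2 , 167) ∷ (3 , 24) ∷ []) ∷ ((3 , 5) ∷ (10 , 1) ∷ []) ∷
    ((1 , 33) ∷ (2 , 33) ∷ (3 , 7) ∷ (4 , 7) ∷ []) ∷ ((5 , 2) ∷ (8 , 1) ∷ []) ∷ ((12 , 1) ∷ (13 , 2) ∷ []) ∷
    ((15 , 1) ∷ (16 , 5) ∷ []) ∷ ((4 , 1) ∷ (7 , 1) ∷ []) ∷ ((2 , 25) ∷ (3 , 5) ∷ (4 , 3) ∷ (5 , 2) ∷ []) ∷ []) ∷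
  (18 , ((1 , 61) ∷ (2 , 21) ∷ (3 , 5) ∷ []) ∷ ((13 , 1) ∷ (14 , 1) ∷ []) ∷ ((2 , 5) ∷ (8 , 1) ∷ []) ∷
    ((3 , 2) ∷ (4 , 1) ∷ []) ∷ ((5 , 2) ∷ (6 , 1) ∷ []) ∷ ((2 , 1) ∷ (17 , 5) ∷ []) ∷ ((7 , 5) ∷ (10 , 1) ∷ []) ∷
    ((3 , 3) ∷ (5 , 1) ∷ []) ∷ []) ∷
  (19 , ((1 , 8) ∷ (2 , 3) ∷ (3 , 1) ∷ []) ∷ ((14 , 1) ∷ []) ∷ ((3 , 1) ∷ (4 , 1) ∷ []) ∷
    ((3 , 10) ∷ (10 , 1) ∷ []) ∷ ((18 , 1) ∷ []) ∷ ((5 , 1) ∷ (6 , 2) ∷ []) ∷ ((5 , 1) ∷ (18 , 10) ∷ []) ∷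
    ((5 , 1) ∷ (8 , 1) ∷ []) ∷ []) ∷
  (20 , ((1 , 10) ∷ (2 , 1) ∷ []) ∷ ((3 , 20) ∷ (10 , 1) ∷ []) ∷ ((14 , 1) ∷ (15 , 2) ∷ []) ∷
    ((1 , 88) ∷ (2 , 50) ∷ (3 , 13) ∷ []) ∷ ((4 , 1) ∷ []) ∷ ((1 , 40) ∷ (2 , 23) ∷ (3 , 6) ∷ (4 , 3) ∷ []) ∷
    ((6 , 1) ∷ (13 , 2) ∷ []) ∷ ((1 , 50) ∷ (12 , 1) ∷ []) ∷ ((3 , 5) ∷ (4 , 1) ∷ []) ∷ ((1 , 50) ∷ (7 , 1) ∷ []) ∷
    ((2 , 1) ∷ (19 , 3) ∷ []) ∷ []) ∷
  (21 , ((1 , 1) ∷ []) ∷ ((3 , 20) ∷ (10 , 1) ∷ []) ∷ ((15 , 1) ∷ (16 , 1) ∷ []) ∷ ((1 , 50) ∷ (6 , 1) ∷ []) ∷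
    ((4 , 10) ∷ (9 , 1) ∷ []) ∷ ((1 , 100) ∷ (2 , 75) ∷ (3 , 25) ∷ []) ∷ ((2 , 5) ∷ (4 , 1) ∷ []) ∷
    ((7 , 1) ∷ (16 , 3) ∷ []) ∷ ((7 , 1) ∷ []) ∷ []) ∷
  (22 , ((1 , 49) ∷ (2 , 15) ∷ (3 , 3) ∷ []) ∷ ((16 , 1) ∷ []) ∷ ((1 , 10) ∷ (2 , 5) ∷ (3 , 1) ∷ (4 , 1) ∷ []) ∷
    ((2 , 3) ∷ (3 , 1) ∷ []) ∷ ((7 , 1) ∷ (19 , 10) ∷ []) ∷ ((14 , 1) ∷ (17 , 5) ∷ []) ∷ ((1 , 50) ∷ (6 , 1) ∷ []) ∷
    ((3 , 10) ∷ (9 , 1) ∷ []) ∷ ((7 , 2) ∷ (10 , 1) ∷ []) ∷ ((4 , 2) ∷ (5 , 1) ∷ []) ∷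
    ((3 , 5) ∷ (4 , 2) ∷ (6 , 1) ∷ []) ∷ []) ∷
  (23 , ((1 , 59) ∷ (2 , 19) ∷ (3 , 5) ∷ []) ∷ ((16 , 1) ∷ (17 , 2) ∷ []) ∷ ((3 , 20) ∷ (13 , 1) ∷ []) ∷
    ((4 , 5) ∷ (16 , 1) ∷ []) ∷ ((5 , 10) ∷ (14 , 1) ∷ []) ∷ ((7 , 1) ∷ (18 , 2) ∷ []) ∷ ((1 , 100) ∷ (9 , 1) ∷ []) ∷
    ((18 , 1) ∷ []) ∷ []) ∷
  (24 , ((1 , 84) ∷ (2 , 25) ∷ (3 , 9) ∷ []) ∷ ((17 , 1) ∷ (18 , 1) ∷ []) ∷ ((3 , 50) ∷ (10 , 1) ∷ []) ∷
    ((5 , 2) ∷ (18 , 1) ∷ []) ∷ ((4 , 3) ∷ (8 , 1) ∷ []) ∷ ((10 , 1) ∷ (11 , 1) ∷ []) ∷ ((5 , 3) ∷ (7 , 1) ∷ []) ∷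
    ((7 , 3) ∷ (8 , 1) ∷ []) ∷ ((2 , 31) ∷ (4 , 7) ∷ (6 , 1) ∷ []) ∷ []) ∷
  (25 , ((1 , 1) ∷ []) ∷ ((18 , 1) ∷ []) ∷ ((1 , 10) ∷ (2 , 1) ∷ []) ∷ ((4 , 20) ∷ (16 , 1) ∷ []) ∷
    ((6 , 5) ∷ (16 , 1) ∷ []) ∷ ((1 , 5) ∷ (3 , 1) ∷ []) ∷ ((9 , 1) ∷ (11 , 2) ∷ []) ∷ ((8 , 1) ∷ (9 , 2) ∷ []) ∷
    ((1 , 20) ∷ (2 , 20) ∷ (3 , 2) ∷ (4 , 2) ∷ []) ∷ ((5 , 2) ∷ (8 , 1) ∷ []) ∷ ((3 , 1) ∷ (23 , 5) ∷ []) ∷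
    ((3 , 3) ∷ (4 , 1) ∷ []) ∷ ((3 , 10) ∷ (4 , 1) ∷ []) ∷ []) ∷
  (26 , ((1 , 40) ∷ (2 , 12) ∷ (3 , 2) ∷ []) ∷ ((5 , 10) ∷ (18 , 1) ∷ []) ∷ ((18 , 1) ∷ (19 , 3) ∷ []) ∷
    ((1 , 57) ∷ (2 , 31) ∷ (3 , 9) ∷ (4 , 3) ∷ []) ∷ ((3 , 50) ∷ (10 , 1) ∷ []) ∷ ((20 , 1) ∷ []) ∷
    ((7 , 1) ∷ (11 , 1) ∷ []) ∷ ((2 , 3) ∷ (3 , 1) ∷ []) ∷ ((3 , 2) ∷ (4 , 1) ∷ []) ∷ ((3 , 20) ∷ (8 , 1) ∷ []) ∷
    []) ∷
  (27 , ((1 , 51) ∷ (2 , 14) ∷ (3 , 4) ∷ []) ∷ ((8 , 1) ∷ (20 , 1) ∷ []) ∷ ((23 , 1) ∷ (24 , 1) ∷ []) ∷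
    ((9 , 1) ∷ (22 , 2) ∷ []) ∷ ((20 , 1) ∷ (21 , 2) ∷ []) ∷ ((2 , 2) ∷ (3 , 1) ∷ []) ∷ ((12 , 1) ∷ []) ∷
    ((1 , 46) ∷ (2 , 38) ∷ (3 , 8) ∷ (4 , 4) ∷ []) ∷ ((4 , 1) ∷ []) ∷ ((5 , 3) ∷ (6 , 1) ∷ []) ∷ []) ∷
  (28 , ((1 , 69) ∷ (2 , 17) ∷ (3 , 6) ∷ []) ∷ ((18 , 1) ∷ (20 , 5) ∷ []) ∷ ((24 , 1) ∷ []) ∷
    ((3 , 1) ∷ (26 , 1) ∷ []) ∷ ((21 , 1) ∷ (22 , 1) ∷ []) ∷ ((12 , 1) ∷ []) ∷ ((4 , 2) ∷ (5 , 1) ∷ []) ∷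
    ((5 , 5) ∷ (6 , 1) ∷ []) ∷ ((6 , 1) ∷ (9 , 1) ∷ []) ∷ ((2 , 38) ∷ (4 , 5) ∷ []) ∷ []) ∷
  (29 , ((1 , 1) ∷ []) ∷ ((1 , 50) ∷ (2 , 19) ∷ (3 , 6) ∷ []) ∷ ((22 , 1) ∷ []) ∷ ((24 , 1) ∷ (25 , 5) ∷ []) ∷
    ((1 , 10) ∷ (2 , 1) ∷ []) ∷ ((2 , 100) ∷ (8 , 1) ∷ []) ∷ ((21 , 1) ∷ (24 , 3) ∷ []) ∷ ((26 , 1) ∷ []) ∷
    ((3 , 10) ∷ (7 , 1) ∷ []) ∷ ((12 , 1) ∷ (16 , 1) ∷ []) ∷ ((6 , 3) ∷ (9 , 1) ∷ []) ∷ ((5 , 1) ∷ []) ∷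
    ((5 , 2) ∷ (6 , 1) ∷ []) ∷ ((1 , 1000) ∷ (10 , 1) ∷ []) ∷ []) ∷
  (30 , ((1 , 35) ∷ (2 , 10) ∷ (3 , 2) ∷ []) ∷ ((7 , 3) ∷ (22 , 1) ∷ []) ∷
    ((1 , 60) ∷ (2 , 20) ∷ (3 , 8) ∷ (27 , 2) ∷ []) ∷ ((10 , 3) ∷ (13 , 1) ∷ []) ∷ ((3 , 100) ∷ (10 , 1) ∷ []) ∷
    ((5 , 5) ∷ (22 , 1) ∷ []) ∷ ((3 , 3) ∷ (5 , 1) ∷ []) ∷ ((1 , 277) ∷ (2 , 207) ∷ (4 , 42) ∷ (5 , 6) ∷ []) ∷
    ((4 , 1) ∷ []) ∷ ((1 , 216) ∷ (5 , 2) ∷ (6 , 1) ∷ []) ∷ ((5 , 1) ∷ (6 , 1) ∷ []) ∷ ((6 , 2) ∷ (7 , 1) ∷ []) ∷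
    ((4 , 10) ∷ (7 , 1) ∷ []) ∷ []) ∷
  (31 , ((1 , 38) ∷ (2 , 11) ∷ (3 , 2) ∷ []) ∷ ((1 , 100) ∷ (2 , 20) ∷ (3 , 15) ∷ (28 , 5) ∷ []) ∷
    ((22 , 1) ∷ (26 , 5) ∷ []) ∷ ((5 , 1) ∷ (27 , 3) ∷ []) ∷ ((23 , 1) ∷ (24 , 1) ∷ []) ∷
    ((3 , 100) ∷ (10 , 1) ∷ []) ∷ ((7 , 1) ∷ (26 , 3) ∷ []) ∷ ((6 , 1) ∷ (7 , 1) ∷ []) ∷ ((1 , 50) ∷ (5 , 1) ∷ []) ∷
    ((6 , 5) ∷ (14 , 1) ∷ []) ∷ ((1 , 33) ∷ (2 , 24) ∷ (3 , 4) ∷ (4 , 2) ∷ []) ∷ []) ∷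
  (32 , ((1 , 20) ∷ (2 , 1) ∷ []) ∷ ((1 , 1000) ∷ (2 , 250) ∷ (3 , 200) ∷ (4 , 25) ∷ []) ∷ ((24 , 1) ∷ []) ∷
    ((2 , 10) ∷ (4 , 1) ∷ []) ∷ ((2 , 50) ∷ (23 , 1) ∷ []) ∷ ((27 , 1) ∷ (28 , 2) ∷ []) ∷ ((7 , 5) ∷ (8 , 1) ∷ []) ∷
    ((6 , 5) ∷ (23 , 1) ∷ []) ∷ ((1 , 41) ∷ (2 , 13) ∷ (3 , 3) ∷ []) ∷ ((10 , 1) ∷ (28 , 10) ∷ []) ∷ ((5 , 1) ∷ []) ∷
    ((11 , 1) ∷ []) ∷ ((6 , 3) ∷ (14 , 1) ∷ []) ∷ []) ∷
  (33 , ((1 , 1) ∷ []) ∷ ((1 , 10) ∷ (3 , 1) ∷ []) ∷ ((8 , 2) ∷ (24 , 1) ∷ []) ∷ ((2 , 10) ∷ (28 , 1) ∷ []) ∷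
    ((1 , 4534) ∷ (6 , 25) ∷ (7 , 1) ∷ []) ∷ ((3 , 50) ∷ (24 , 1) ∷ []) ∷ ((3 , 140) ∷ (4 , 185) ∷ (6 , 14) ∷ []) ∷
    ((2 , 10) ∷ (4 , 1) ∷ []) ∷ ((6 , 1) ∷ (28 , 3) ∷ []) ∷ ((11 , 1) ∷ []) ∷ ((7 , 1) ∷ (27 , 1) ∷ []) ∷
    ((3 , 3) ∷ (5 , 1) ∷ []) ∷ ((7 , 1) ∷ (27 , 3) ∷ []) ∷ ((1 , 45) ∷ (2 , 14) ∷ (3 , 5) ∷ []) ∷
    ((1 , 481) ∷ (2 , 259) ∷ (3 , 111) ∷ (4 , 37) ∷ []) ∷ ((3 , 1) ∷ []) ∷ ((4 , 2) ∷ (5 , 1) ∷ []) ∷ []) ∷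
  (34 , ((1 , 32) ∷ (2 , 8) ∷ (3 , 1) ∷ []) ∷ ((25 , 1) ∷ (26 , 1) ∷ []) ∷
    ((1 , 34) ∷ (2 , 12) ∷ (3 , 3) ∷ (4 , 1) ∷ []) ∷ ((3 , 10) ∷ (30 , 1) ∷ []) ∷ ((29 , 1) ∷ (32 , 5) ∷ []) ∷
    ((4 , 10) ∷ (6 , 1) ∷ []) ∷ ((6 , 1) ∷ (7 , 1) ∷ []) ∷ ((24 , 1) ∷ (28 , 3) ∷ []) ∷
    ((1 , 42) ∷ (2 , 26) ∷ (3 , 11) ∷ (4 , 5) ∷ []) ∷ ((7 , 2) ∷ (8 , 1) ∷ []) ∷
    ((2 , 2121) ∷ (3 , 344) ∷ (4 , 222) ∷ (5 , 41) ∷ []) ∷ ((1 , 38) ∷ (3 , 4) ∷ (4 , 1) ∷ []) ∷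
    ((5 , 50) ∷ (6 , 68) ∷ (9 , 2) ∷ []) ∷ ((3 , 34) ∷ (4 , 16) ∷ (6 , 4) ∷ []) ∷ []) ∷
  (35 , ((1 , 35) ∷ (2 , 9) ∷ (3 , 2) ∷ []) ∷ ((26 , 1) ∷ []) ∷ ((1 , 33) ∷ (2 , 13) ∷ (3 , 3) ∷ (4 , 1) ∷ []) ∷
    ((7 , 1) ∷ (32 , 10) ∷ []) ∷ ((1 , 50) ∷ (30 , 1) ∷ []) ∷ ((3 , 5) ∷ (31 , 1) ∷ []) ∷
    ((1 , 100) ∷ (3 , 10) ∷ (4 , 8) ∷ (5 , 2) ∷ []) ∷ ((29 , 1) ∷ (30 , 3) ∷ []) ∷ ((3 , 1) ∷ (33 , 2) ∷ []) ∷
    ((6 , 300) ∷ (15 , 1) ∷ []) ∷ ((3 , 2) ∷ (4 , 1) ∷ []) ∷ ((4 , 10) ∷ (6 , 1) ∷ []) ∷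
    ((1 , 3) ∷ (2 , 3) ∷ (3 , 1) ∷ (4 , 1) ∷ []) ∷ ((2 , 192) ∷ (3 , 43) ∷ (4 , 26) ∷ (5 , 5) ∷ []) ∷
    ((1 , 1256) ∷ (2 , 122) ∷ (5 , 12) ∷ (6 , 7) ∷ []) ∷ ((2 , 1368) ∷ (3 , 149) ∷ (4 , 86) ∷ (5 , 25) ∷ []) ∷ []) ∷
  (36 , ((1 , 20) ∷ (2 , 1) ∷ []) ∷ ((1 , 38) ∷ (2 , 10) ∷ (3 , 3) ∷ []) ∷ ((9 , 3) ∷ (26 , 1) ∷ []) ∷
    ((3 , 1) ∷ (34 , 1) ∷ []) ∷ ((4 , 1) ∷ (34 , 3) ∷ []) ∷ ((9 , 1) ∷ (30 , 3) ∷ []) ∷ ((2 , 1) ∷ (31 , 1) ∷ []) ∷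
    ((6 , 1) ∷ (29 , 2) ∷ []) ∷ ((26 , 1) ∷ []) ∷ ((1 , 2) ∷ (2 , 1) ∷ []) ∷ ((3 , 10) ∷ (6 , 1) ∷ []) ∷
    ((8 , 20) ∷ (24 , 1) ∷ []) ∷ ((7 , 3) ∷ (8 , 1) ∷ []) ∷ ((6 , 3) ∷ (9 , 1) ∷ []) ∷ ((4 , 10) ∷ (7 , 1) ∷ []) ∷
    ((4 , 13) ∷ (5 , 3) ∷ (6 , 2) ∷ []) ∷ ((6 , 30) ∷ (7 , 11) ∷ (10 , 1) ∷ []) ∷
    ((1 , 1248) ∷ (3 , 58) ∷ (4 , 73) ∷ (5 , 25) ∷ []) ∷ ((2 , 1191) ∷ (3 , 161) ∷ (4 , 76) ∷ (5 , 23) ∷ []) ∷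
    ((2 , 1800) ∷ (3 , 436) ∷ (4 , 320) ∷ (5 , 63) ∷ []) ∷ []) ∷
  (37 , ((1 , 100) ∷ (2 , 27) ∷ (3 , 6) ∷ []) ∷ ((5 , 20) ∷ (27 , 1) ∷ []) ∷ ((26 , 1) ∷ (30 , 10) ∷ []) ∷
    ((2 , 46) ∷ (3 , 83) ∷ (5 , 11) ∷ []) ∷ ((4 , 3) ∷ (32 , 1) ∷ []) ∷ ((5 , 3) ∷ (8 , 1) ∷ []) ∷
    ((6 , 1) ∷ (34 , 10) ∷ []) ∷ ((4 , 1) ∷ (31 , 1) ∷ []) ∷ ((33 , 1) ∷ (34 , 5) ∷ []) ∷ ((7 , 2) ∷ (8 , 1) ∷ []) ∷
    ((26 , 1) ∷ (27 , 2) ∷ []) ∷ ((36 , 1) ∷ []) ∷ ((4 , 5) ∷ (6 , 1) ∷ []) ∷ ((4 , 10) ∷ (7 , 1) ∷ []) ∷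
    ((5 , 3) ∷ (29 , 1) ∷ []) ∷ ((9 , 1) ∷ (10 , 1) ∷ []) ∷ ((1 , 15) ∷ (2 , 17) ∷ (4 , 2) ∷ []) ∷
    ((6 , 178) ∷ (7 , 169) ∷ (10 , 7) ∷ []) ∷ ((1 , 146) ∷ (3 , 2) ∷ (4 , 6) ∷ (5 , 3) ∷ []) ∷ []) ∷
  (38 , ((1 , 20) ∷ (2 , 1) ∷ []) ∷ ((28 , 1) ∷ (32 , 2) ∷ []) ∷ ((1 , 56) ∷ (2 , 11) ∷ (3 , 6) ∷ []) ∷
    ((2 , 10) ∷ (4 , 1) ∷ []) ∷ ((1 , 3) ∷ (3 , 17) ∷ (4 , 9) ∷ (5 , 3) ∷ []) ∷ ((35 , 1) ∷ (36 , 3) ∷ []) ∷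
    ((8 , 1) ∷ (33 , 10) ∷ []) ∷ ((1 , 300) ∷ (27 , 1) ∷ []) ∷ ((4 , 5) ∷ (8 , 1) ∷ []) ∷ ((5 , 5) ∷ (9 , 1) ∷ []) ∷
    ((1 , 178) ∷ (4 , 3) ∷ (5 , 3) ∷ []) ∷ ((3 , 1) ∷ []) ∷ ((4 , 1) ∷ []) ∷ ((7 , 2) ∷ (8 , 1) ∷ []) ∷
    ((1 , 300) ∷ (6 , 1) ∷ []) ∷ ((1 , 100) ∷ (3 , 98) ∷ (6 , 2) ∷ (7 , 3) ∷ []) ∷ []) ∷
  (39 , ((1 , 43) ∷ (2 , 10) ∷ (3 , 2) ∷ []) ∷ ((4 , 1) ∷ (36 , 5) ∷ []) ∷ ((28 , 1) ∷ []) ∷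
    ((3 , 5) ∷ (5 , 1) ∷ []) ∷ ((1 , 10) ∷ (2 , 1) ∷ (3 , 1) ∷ []) ∷ ((32 , 1) ∷ (34 , 10) ∷ []) ∷
    ((5 , 3) ∷ (31 , 1) ∷ []) ∷ ((4 , 2) ∷ (6 , 1) ∷ []) ∷ ((2 , 10) ∷ (4 , 1) ∷ []) ∷ ((2 , 2) ∷ (3 , 1) ∷ []) ∷
    ((1 , 50) ∷ (5 , 1) ∷ []) ∷ ((9 , 1) ∷ []) ∷ ((13 , 1) ∷ []) ∷ ((6 , 5) ∷ (31 , 1) ∷ []) ∷
    ((3 , 10) ∷ (4 , 10) ∷ (5 , 1) ∷ (6 , 1) ∷ []) ∷ ((1 , 664) ∷ (3 , 79) ∷ (6 , 1) ∷ (7 , 3) ∷ []) ∷ []) ∷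
  (40 , ((1 , 20) ∷ (2 , 1) ∷ []) ∷ ((1 , 100) ∷ (2 , 16) ∷ (3 , 11) ∷ (4 , 1) ∷ []) ∷ ((32 , 1) ∷ (34 , 2) ∷ []) ∷
    ((1 , 30) ∷ (2 , 16) ∷ (3 , 3) ∷ (4 , 1) ∷ []) ∷ ((2 , 1) ∷ (5 , 1) ∷ []) ∷ ((37 , 1) ∷ (38 , 2) ∷ []) ∷
    ((1 , 62) ∷ (3 , 7) ∷ (4 , 4) ∷ (5 , 1) ∷ []) ∷ ((6 , 50) ∷ (9 , 1) ∷ []) ∷ ((29 , 1) ∷ (33 , 2) ∷ []) ∷
    ((5 , 3) ∷ (34 , 1) ∷ []) ∷ ((1 , 1000) ∷ (8 , 1) ∷ []) ∷ ((34 , 1) ∷ []) ∷ ((3 , 5) ∷ (4 , 1) ∷ []) ∷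
    ((3 , 2) ∷ (6 , 1) ∷ []) ∷ ((2 , 10) ∷ (3 , 1) ∷ []) ∷ ((4 , 10) ∷ (6 , 1) ∷ []) ∷ ((10 , 2) ∷ (11 , 1) ∷ []) ∷
    ((12 , 2) ∷ (13 , 1) ∷ []) ∷ ((1 , 224) ∷ (2 , 15) ∷ (5 , 4) ∷ (6 , 1) ∷ []) ∷ []) ∷
  (41 , ((1 , 1) ∷ []) ∷ ((1 , 674) ∷ (2 , 198) ∷ (3 , 35) ∷ []) ∷ ((5 , 1) ∷ (38 , 10) ∷ []) ∷
    ((1 , 100) ∷ (2 , 20) ∷ (3 , 11) ∷ (4 , 2) ∷ []) ∷ ((29 , 1) ∷ (33 , 10) ∷ []) ∷ ((4 , 1) ∷ (5 , 2) ∷ []) ∷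
    ((7 , 10) ∷ (8 , 1) ∷ []) ∷ ((1 , 5) ∷ (2 , 1) ∷ []) ∷ ((4 , 7) ∷ (5 , 1) ∷ (6 , 1) ∷ []) ∷
    ((1 , 243) ∷ (2 , 30) ∷ (5 , 3) ∷ (6 , 1) ∷ []) ∷ ((3 , 1) ∷ []) ∷
    ((2 , 145) ∷ (3 , 10) ∷ (4 , 9) ∷ (5 , 2) ∷ []) ∷ ((10 , 1) ∷ []) ∷ ((3 , 10) ∷ (6 , 1) ∷ []) ∷
    ((1 , 3000) ∷ (8 , 1) ∷ []) ∷ ((32 , 1) ∷ (35 , 10) ∷ []) ∷ ((1 , 3000) ∷ (11 , 1) ∷ []) ∷ ((9 , 1) ∷ []) ∷
    ((3 , 10) ∷ (7 , 1) ∷ []) ∷ []) ∷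
  (42 , ((1 , 26) ∷ (2 , 6) ∷ (3 , 1) ∷ []) ∷ ((2 , 1) ∷ (3 , 2) ∷ []) ∷
    ((1 , 90) ∷ (3 , 4) ∷ (4 , 3) ∷ (5 , 1) ∷ []) ∷ ((11 , 1) ∷ (34 , 10) ∷ []) ∷
    ((2 , 137) ∷ (3 , 16) ∷ (4 , 9) ∷ (5 , 2) ∷ []) ∷ ((2 , 1) ∷ (39 , 2) ∷ []) ∷
    ((1 , 33) ∷ (2 , 18) ∷ (3 , 4) ∷ (4 , 2) ∷ []) ∷ ((4 , 5) ∷ (36 , 1) ∷ []) ∷ ((5 , 20) ∷ (6 , 1) ∷ []) ∷
    ((1 , 54) ∷ (2 , 18) ∷ (3 , 4) ∷ []) ∷ ((1 , 2541) ∷ (2 , 456) ∷ (5 , 20) ∷ (6 , 15) ∷ []) ∷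
    ((6 , 2) ∷ (35 , 1) ∷ []) ∷ ((5 , 5) ∷ (9 , 1) ∷ []) ∷ ((7 , 3) ∷ (8 , 1) ∷ []) ∷ ((3 , 20) ∷ (36 , 1) ∷ []) ∷
    ((8 , 1) ∷ (36 , 10) ∷ []) ∷ ((1 , 100000) ∷ (12 , 1) ∷ []) ∷
    ((4 , 3373) ∷ (5 , 711) ∷ (7 , 206) ∷ (8 , 95) ∷ []) ∷ ((10 , 1) ∷ []) ∷ ((13 , 1) ∷ []) ∷
    ((3 , 10) ∷ (5 , 1) ∷ []) ∷ ((7 , 1) ∷ (36 , 3) ∷ []) ∷ ((6 , 632) ∷ (7 , 213) ∷ (8 , 22) ∷ (9 , 1) ∷ []) ∷
    ((2 , 1293) ∷ (3 , 200) ∷ (4 , 65) ∷ (5 , 30) ∷ []) ∷ []) ∷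
  (43 , ((1 , 31) ∷ (2 , 7) ∷ (3 , 1) ∷ []) ∷ ((4 , 20) ∷ (34 , 1) ∷ []) ∷ ((3 , 20) ∷ (4 , 1) ∷ []) ∷
    ((1 , 48) ∷ (2 , 12) ∷ (3 , 3) ∷ (4 , 1) ∷ []) ∷ ((34 , 1) ∷ (35 , 2) ∷ []) ∷ ((5 , 1) ∷ (7 , 1) ∷ []) ∷
    ((5 , 5) ∷ (6 , 1) ∷ []) ∷ ((40 , 1) ∷ (41 , 2) ∷ []) ∷ ((6 , 100) ∷ (11 , 1) ∷ []) ∷ ((4 , 3) ∷ (37 , 1) ∷ []) ∷
    ((35 , 1) ∷ (37 , 5) ∷ []) ∷ ((2 , 117) ∷ (3 , 25) ∷ (4 , 6) ∷ (5 , 3) ∷ []) ∷ ((5 , 1) ∷ (39 , 3) ∷ []) ∷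
    ((37 , 1) ∷ (39 , 10) ∷ []) ∷ ((1 , 10000) ∷ (9 , 1) ∷ []) ∷ ((1 , 100000) ∷ (12 , 1) ∷ []) ∷
    ((3 , 8708) ∷ (7 , 196) ∷ (8 , 69) ∷ (9 , 4) ∷ []) ∷ ((42 , 1) ∷ []) ∷ ((1 , 300) ∷ (6 , 1) ∷ []) ∷
    ((3 , 14) ∷ (4 , 4) ∷ (5 , 2) ∷ []) ∷ ((1 , 104) ∷ (3 , 3) ∷ (4 , 3) ∷ (5 , 1) ∷ []) ∷
    ((4 , 250) ∷ (5 , 121) ∷ (7 , 13) ∷ (8 , 11) ∷ []) ∷ ((1 , 697) ∷ (2 , 697) ∷ (5 , 12) ∷ (6 , 12) ∷ []) ∷
    ((1 , 195) ∷ (2 , 195) ∷ (3 , 24) ∷ (4 , 24) ∷ []) ∷ []) ∷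
  (44 , ((1 , 34) ∷ (2 , 7) ∷ (3 , 2) ∷ []) ∷ ((7 , 1) ∷ (35 , 1) ∷ []) ∷ ((4 , 1) ∷ (41 , 10) ∷ []) ∷
    ((5 , 1) ∷ (40 , 5) ∷ []) ∷ ((3 , 598) ∷ (6 , 14) ∷ (7 , 14) ∷ []) ∷
    ((1 , 122) ∷ (4 , 4) ∷ (5 , 1) ∷ (6 , 3) ∷ []) ∷ ((2 , 104) ∷ (3 , 29) ∷ (4 , 6) ∷ (5 , 3) ∷ []) ∷
    ((4 , 100) ∷ (9 , 1) ∷ []) ∷ ((35 , 1) ∷ (38 , 10) ∷ []) ∷ ((3 , 17) ∷ (4 , 4) ∷ (6 , 1) ∷ []) ∷
    ((1 , 5) ∷ (42 , 1) ∷ []) ∷ ((9 , 1) ∷ (37 , 10) ∷ []) ∷ ((1 , 100000) ∷ (12 , 1) ∷ []) ∷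
    ((1 , 20) ∷ (2 , 12) ∷ (3 , 1) ∷ (4 , 1) ∷ []) ∷ ((7 , 1) ∷ []) ∷ ((3 , 10) ∷ (5 , 1) ∷ []) ∷
    ((3 , 1) ∷ (42 , 10) ∷ []) ∷ ((1 , 3000) ∷ (8 , 1) ∷ []) ∷ ((1 , 637) ∷ (2 , 156) ∷ (3 , 34) ∷ (4 , 17) ∷ []) ∷
    []) ∷
  (45 , ((1 , 1) ∷ []) ∷ ((1 , 40) ∷ (2 , 8) ∷ (3 , 3) ∷ []) ∷ ((1 , 380) ∷ (4 , 12) ∷ (5 , 3) ∷ []) ∷
    ((1 , 7409) ∷ (6 , 10) ∷ (7 , 5) ∷ []) ∷ ((3 , 100) ∷ (38 , 1) ∷ []) ∷ ((5 , 1) ∷ (42 , 10) ∷ []) ∷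
    ((2 , 10) ∷ (4 , 1) ∷ []) ∷ ((36 , 1) ∷ []) ∷ ((5 , 3) ∷ (7 , 1) ∷ []) ∷ ((2 , 1) ∷ (41 , 1) ∷ []) ∷
    ((3 , 52) ∷ (4 , 44) ∷ (5 , 12) ∷ (6 , 4) ∷ []) ∷ ((7 , 10) ∷ (36 , 1) ∷ []) ∷ ((3 , 10) ∷ (39 , 1) ∷ []) ∷
    ((1 , 53) ∷ (2 , 14) ∷ (3 , 3) ∷ []) ∷ ((8 , 1) ∷ (9 , 1) ∷ []) ∷ ((1 , 3) ∷ (42 , 1) ∷ []) ∷
    ((1 , 100000) ∷ (12 , 1) ∷ []) ∷ ((2 , 52) ∷ (3 , 41) ∷ (5 , 4) ∷ []) ∷
    ((1 , 989) ∷ (2 , 278) ∷ (3 , 33) ∷ (4 , 33) ∷ []) ∷ ((44 , 1) ∷ []) ∷ ((5 , 3) ∷ (8 , 1) ∷ []) ∷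
    ((2 , 10) ∷ (3 , 1) ∷ []) ∷ ((4 , 10) ∷ (8 , 1) ∷ []) ∷ ((4 , 2) ∷ (40 , 1) ∷ []) ∷ ((3 , 1) ∷ (43 , 10) ∷ []) ∷
    ((1 , 3000) ∷ (8 , 1) ∷ []) ∷ ((1 , 1147) ∷ (5 , 33) ∷ (6 , 5) ∷ (7 , 5) ∷ []) ∷
    ((1 , 2589) ∷ (2 , 647) ∷ (6 , 2) ∷ (9 , 1) ∷ []) ∷ []) ∷
  (46 , ((1 , 54) ∷ (2 , 8) ∷ (3 , 3) ∷ []) ∷ ((1 , 403) ∷ (3 , 36) ∷ (4 , 2) ∷ (5 , 5) ∷ []) ∷
    ((36 , 1) ∷ (37 , 2) ∷ []) ∷ ((5 , 1) ∷ (43 , 10) ∷ []) ∷ ((4 , 620) ∷ (6 , 23) ∷ (7 , 23) ∷ []) ∷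
    ((7 , 1) ∷ (40 , 3) ∷ []) ∷ ((6 , 1) ∷ (8 , 1) ∷ []) ∷ ((5 , 2) ∷ (39 , 1) ∷ []) ∷
    ((1 , 391) ∷ (2 , 43) ∷ (3 , 69) ∷ (5 , 5) ∷ []) ∷ ((6 , 1) ∷ (42 , 10) ∷ []) ∷ ((9 , 1) ∷ (39 , 10) ∷ []) ∷
    ((7 , 5) ∷ (37 , 1) ∷ []) ∷ ((1 , 300) ∷ (40 , 1) ∷ []) ∷ ((1 , 1000000) ∷ (13 , 1) ∷ []) ∷
    ((3 , 55) ∷ (4 , 75) ∷ (6 , 24) ∷ (7 , 10) ∷ []) ∷ ((4 , 1) ∷ (43 , 5) ∷ []) ∷
    ((2 , 20953) ∷ (3 , 9361) ∷ (9 , 8) ∷ (10 , 14) ∷ []) ∷ []) ∷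
  (47 , ((1 , 34) ∷ (2 , 8) ∷ (3 , 1) ∷ []) ∷ ((1 , 100) ∷ (2 , 8) ∷ (3 , 8) ∷ []) ∷ ((37 , 1) ∷ (38 , 1) ∷ []) ∷
    ((5 , 1) ∷ (43 , 5) ∷ []) ∷ ((3 , 10) ∷ (5 , 1) ∷ []) ∷ ((5 , 1) ∷ (46 , 10) ∷ []) ∷
    ((1 , 31) ∷ (2 , 12) ∷ (3 , 2) ∷ (4 , 1) ∷ []) ∷ ((4 , 20) ∷ (41 , 1) ∷ []) ∷
    ((3 , 625) ∷ (4 , 652) ∷ (6 , 158) ∷ (7 , 142) ∷ []) ∷ ((40 , 1) ∷ []) ∷ ((4 , 5) ∷ (6 , 1) ∷ []) ∷
    ((8 , 1) ∷ []) ∷ ((1 , 156) ∷ (4 , 6) ∷ (5 , 2) ∷ (6 , 1) ∷ []) ∷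
    ((1 , 65516) ∷ (3 , 8748) ∷ (38 , 41) ∷ (44 , 4348) ∷ []) ∷ ((8 , 2) ∷ (9 , 1) ∷ []) ∷ ((3 , 1) ∷ []) ∷
    ((5 , 3) ∷ (7 , 1) ∷ []) ∷ ((2 , 100) ∷ (7 , 1) ∷ []) ∷ ((3 , 100) ∷ (8 , 1) ∷ []) ∷
    ((1 , 1000000) ∷ (13 , 1) ∷ []) ∷ ((1 , 636) ∷ (2 , 273) ∷ (3 , 55) ∷ []) ∷
    ((3 , 38) ∷ (4 , 2) ∷ (5 , 1) ∷ (6 , 1) ∷ []) ∷ []) ∷
  []

-- Layers of words

weight : F₂^ n → ℕ
weight {n} = hamming (replicate n false)

∈-words⁻ : ∀ n k {x} → x ∈ words n k → weight x ≡ k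
∈-words⁻ n       zero    (here refl) = hamming-self (replicate n false)
∈-words⁻ (suc n) (suc k) x∈ with ∈-++⁻ (map (false ∷_) (words n (suc k))) x∈
... | inj₁ x∈₀ with y , y∈ , refl ← ∈-map⁻ (false ∷_) x∈₀ = ∈-words⁻ n (suc k) y∈
... | inj₂ x∈₁ with y , y∈ , refl ← ∈-map⁻ (true ∷_) x∈₁ = cong suc (∈-words⁻ n k y∈)

∈-words⁺ : (x : F₂^ n) → x ∈ words n (weight x)
∈-words⁺ []          = here refl
∈-words⁺ (true  ∷ x) = ∈-++⁺ʳ (map (false ∷_) (words _ (suc (weight x)))) (∈-map⁺ (true ∷_) (∈-words⁺ x))
∈-words⁺ (false ∷ x) with weight x | ∈-words⁺ x
... | zero  | here refl = here refl
... | suc k | x∈        = ∈-++⁺ˡ (∈-map⁺ (false ∷_) x∈)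

words-unique : ∀ n k → Unique (words n k)
words-unique n       zero    = [] ∷ []
words-unique zero    (suc k) = []
words-unique (suc n) (suc k) = Unique.++⁺
  (Unique.map⁺ (λ { refl → refl }) (words-unique n (suc k)))
  (Unique.map⁺ (λ { refl → refl }) (words-unique n k))
  λ (x∈₀ , x∈₁) → case (∈-map⁻ (false ∷_) x∈₀ , ∈-map⁻ (true ∷_) x∈₁) of λ { ((_ , _ , refl) , (_ , _ , ())) }

∈-layers⁻ : ∀ n ks {x} → x ∈ layers n ks → weight x ∈ ks
∈-layers⁻ n (k ∷ ks) x∈ with ∈-++⁻ (words n k) x∈
... | inj₁ x∈k  = here (∈-words⁻ n k x∈k)
... | inj₂ x∈ks = there (∈-layers⁻ n ks x∈ks)

∈-layers⁺ : ∀ {ks} (x : F₂^ n) → weight x ∈ ks → x ∈ layers n ks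
∈-layers⁺ x (here refl) = ∈-++⁺ˡ (∈-words⁺ x)
∈-layers⁺ {n} {k ∷ _} x (there w∈) = ∈-++⁺ʳ (words n k) (∈-layers⁺ x w∈)

layers-unique : ∀ n {ks} → Unique ks → Unique (layers n ks)
layers-unique n []         = []
layers-unique n {k ∷ ks} (k≢ ∷ ks!) = Unique.++⁺ (words-unique n k) (layers-unique n ks!)
  λ (x∈k , x∈ks) → All.lookup k≢ (∈-layers⁻ n ks x∈ks) (sym (∈-words⁻ n k x∈k))

common : F₂^ n → F₂^ n → ℕ
common []          []          = 0
common (true  ∷ x) (true  ∷ y) = suc (common x y)
common (true  ∷ x) (false ∷ y) = common x y
common (false ∷ x) (_     ∷ y) = common x y

-- The distance is the size of the symmetric difference of the supports. It therefore has the parity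
-- of the sum of the weights and cannot exceed that sum.
hamming+2common : (x y : F₂^ n) → hamming x y ℕ.+ 2 ℕ.* common x y ≡ weight x ℕ.+ weight y
hamming+2common []          []          = refl
hamming+2common (false ∷ x) (false ∷ y) = hamming+2common x y
hamming+2common (false ∷ x) (true  ∷ y) = trans (cong suc (hamming+2common x y)) (sym (ℕ.+-suc (weight x) (weight y)))
hamming+2common (true  ∷ x) (false ∷ y) = cong suc (hamming+2common x y)
hamming+2common (true  ∷ x) (true  ∷ y) = begin
  hamming x y ℕ.+ 2 ℕ.* suc (common x y)           ≡⟨ cong (hamming x y ℕ.+_) (ℕ.*-suc 2 (common x y)) ⟩
  hamming x y ℕ.+ (2 ℕ.+ 2 ℕ.* common x y)         ≡⟨ ℕ.+-comm (hamming x y) _ ⟩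
  2 ℕ.+ (2 ℕ.* common x y ℕ.+ hamming x y)         ≡⟨ cong (2 ℕ.+_) (trans (ℕ.+-comm _ (hamming x y))
                                                                          (hamming+2common x y)) ⟩
  suc (suc (weight x ℕ.+ weight y))                ≡⟨ cong suc (sym (ℕ.+-suc (weight x) (weight y))) ⟩
  suc (weight x ℕ.+ suc (weight y)) ∎
  where open ≡-Reasoning

-- Unions of layers as s-distance sets

evens : ℕ → List ℕ
evens s = map (λ i → 2 ℕ.* suc i) (upTo s)

∈-evens : ∀ {s d} → 0 ℕ.< d → d ℕ.≤ 2 ℕ.* s → 2 ℕ.∣ d → d ∈ evens s
∈-evens {s} d>0 d≤ (ℕ.divides zero    refl) = contradiction d>0 λ ()
∈-evens {s} d>0 d≤ (ℕ.divides (suc i) refl) = subst (_∈ evens s) (ℕ.*-comm 2 (suc i))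
  (∈-map⁺ (λ i → 2 ℕ.* suc i) (∈-upTo⁺ (ℕ.*-cancelˡ-≤ 2 (subst (ℕ._≤ 2 ℕ.* s) (ℕ.*-comm (suc i) 2) d≤))))

EvenPairs : ℕ → List ℕ → Set
EvenPairs s ks = All (λ k → All (λ l → 2 ℕ.∣ k ℕ.+ l × k ℕ.+ l ℕ.≤ 2 ℕ.* s) ks) ks

evenPairs? : ∀ s ks → Dec (EvenPairs s ks)
evenPairs? s ks = All.all? (λ k → All.all? (λ l → (2 ℕ.∣? k ℕ.+ l) ×-dec (k ℕ.+ l ℕ.≤? 2 ℕ.* s)) ks) ks

-- `EvenPairs` confines the distances to 2, 4, ..., 2s. Since exactly s distances are required, that
-- each of them occurs is a separate assumption.
layers-distances : ∀ n {s ks} → Unique ks → EvenPairs s ks →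
  All (IsDistanceOf (layers n ks)) (evens s) → IsSDistanceSet n s (layers n ks)
layers-distances n {s} {ks} ks! even attained =
  layers-unique n ks! , evens s ,
  Unique.map⁺ (λ {i} {j} eq → ℕ.suc-injective (ℕ.*-cancelˡ-≡ (suc i) (suc j) 2 eq)) (Unique.upTo⁺ s) ,
  trans (length-map _ (upTo s)) (length-upTo s) ,
  λ d → mk⇔ (All.lookup attained) distance
  where
  distance : ∀ {d} → IsDistanceOf (layers n ks) d → d ∈ evens s
  distance (x , y , x∈ , y∈ , x≢y , refl) = ∈-evens {s} (ℕ.n≢0⇒n>0 (x≢y ∘ hamming≡0⇒≡ x y))
    (ℕ.≤-trans (ℕ.≤-trans (ℕ.m≤m+n (hamming x y) _) (ℕ.≤-reflexive (hamming+2common x y))) (proj₂ pair))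
    (ℕ.∣m+n∣m⇒∣n (subst (2 ℕ.∣_) (trans (sym (hamming+2common x y)) (ℕ.+-comm (hamming x y) _)) (proj₁ pair))
      (ℕ.m∣m*n (common x y)))
    where
    pair = All.lookup (All.lookup even (∈-layers⁻ n ks x∈)) (∈-layers⁻ n ks y∈)

-- Eight coordinates suffice for all witnesses: the largest distance needed, 8, comes from two
-- disjoint supports of size 4.
pad : ∀ m → Vec Bool 8 → F₂^ (8 ℕ.+ m)
pad m p = p Vec.++ replicate m false

hamming-++ : ∀ {l} (p q : F₂^ l) (z : F₂^ n) → hamming (p Vec.++ z) (q Vec.++ z) ≡ hamming p q
hamming-++ []          []          z = hamming-self z
hamming-++ (a ∷ p) (b ∷ q) z = cong ((if a xor b then 1 else 0) ℕ.+_) (hamming-++ p q z)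

pad-distance : ∀ m ks p q → weight p ∈ ks → weight q ∈ ks → hamming p q ≢ 0 →
  IsDistanceOf (layers (8 ℕ.+ m) ks) (hamming p q)
pad-distance m ks p q wp wq ≢0 =
  pad m p , pad m q , member p wp , member q wq , distinct-pads , hamming-++ p q (replicate m false)
  where
  member : ∀ p → weight p ∈ ks → pad m p ∈ layers (8 ℕ.+ m) ks
  member p wp = ∈-layers⁺ (pad m p) (subst (_∈ ks) (sym (hamming-++ (replicate 8 false) p (replicate m false))) wp)
  distinct-pads : pad m p ≢ pad m q
  distinct-pads eq = ≢0 (trans (sym (hamming-++ p q (replicate m false)))
    (trans (cong (hamming (pad m p)) (sym eq)) (hamming-self (pad m p))))

block : ∀ {l} → ℕ → ℕ → Vec Bool l
block {zero}  i       j       = []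
block {suc l} (suc i) j       = false ∷ block i j
block {suc l} zero    (suc j) = true ∷ block zero j
block {suc l} zero    zero    = false ∷ block zero zero

-- The two blocks in each pair have disjoint supports, so their distance is the sum of their
-- weights: 1 + 1, 1 + 3, 3 + 3 here, and 0 + 2, 0 + 4, 2 + 4, 4 + 4 for s = 4.
attained₃ : ∀ m → All (IsDistanceOf (layers (8 ℕ.+ m) (1 ∷ 3 ∷ []))) (evens 3)
attained₃ m =
  pad-distance m (1 ∷ 3 ∷ []) (block 0 1) (block 1 1) (here refl) (here refl) (λ ()) ∷
  pad-distance m (1 ∷ 3 ∷ []) (block 0 1) (block 1 3) (here refl) (there (here refl)) (λ ()) ∷
  pad-distance m (1 ∷ 3 ∷ []) (block 0 3) (block 3 3) (there (here refl)) (there (here refl)) (λ ()) ∷ []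

attained₄ : ∀ m → All (IsDistanceOf (layers (8 ℕ.+ m) (0 ∷ 2 ∷ 4 ∷ []))) (evens 4)
attained₄ m =
  pad-distance m (0 ∷ 2 ∷ 4 ∷ []) (block 0 0) (block 0 2) (here refl) (there (here refl)) (λ ()) ∷
  pad-distance m (0 ∷ 2 ∷ 4 ∷ []) (block 0 0) (block 0 4) (here refl) (there (there (here refl))) (λ ()) ∷
  pad-distance m (0 ∷ 2 ∷ 4 ∷ []) (block 0 2) (block 2 4) (there (here refl)) (there (there (here refl))) (λ ()) ∷
  pad-distance m (0 ∷ 2 ∷ 4 ∷ []) (block 0 4) (block 4 4) (there (there (here refl))) (there (there (here refl))) (λ ()) ∷ []

-- Evaluation of the checks and assembly

bound₃ bound₄ : ℕ → ℕ
bound₃ n = n + n C 3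
bound₄ n = 1 + n C 2 + n C 4

-- Proved by evaluation. Distances up to 44, the largest length in (1), suffice for all lengths at
-- once; for (2) the corresponding limit is 47.
check₃ : check 3 bound₃ (filter integral? (subsets 3 44)) certificates₃ ≡ true
check₃ = refl

check₄ : check 4 bound₄ (filter integral? (subsets 4 47)) certificates₄ ≡ true
check₄ = refl

Valid₃ Valid₄ : ℕ → Set
Valid₃ n = (8 ≤ n × n ≤ 22) ⊎ (24 ≤ n × n ≤ 33) ⊎ n ≡ 36 ⊎ n ≡ 37 ⊎ n ≡ 44
Valid₄ n = 10 ≤ n × n ≤ 47

valid₃? : ∀ n → Dec (Valid₃ n)
valid₃? n = (8 ℕ.≤? n ×-dec n ℕ.≤? 22) ⊎-dec (24 ℕ.≤? n ×-dec n ℕ.≤? 33) ⊎-dec n ℕ.≟ 36 ⊎-dec n ℕ.≟ 37 ⊎-dec n ℕ.≟ 44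

valid₃⇒≤44 : ∀ {n} → Valid₃ n → n ≤ 44
valid₃⇒≤44 (inj₁ (_ , n≤22))               = ℕ.≤-trans n≤22 (ℕ.m≤m+n 22 22)
valid₃⇒≤44 (inj₂ (inj₁ (_ , n≤33)))        = ℕ.≤-trans n≤33 (ℕ.m≤m+n 33 11)
valid₃⇒≤44 (inj₂ (inj₂ (inj₁ refl)))        = ℕ.m≤m+n 36 8
valid₃⇒≤44 (inj₂ (inj₂ (inj₂ (inj₁ refl)))) = ℕ.m≤m+n 37 7
valid₃⇒≤44 (inj₂ (inj₂ (inj₂ (inj₂ refl)))) = ℕ.≤-refl

valid₃ : ∀ {n} → n ℕ.< 45 → Valid₃ n → 8 ≤ n × n ∈ map proj₁ certificates₃
valid₃ = from-yes (ℕ.allUpTo? (λ n → valid₃? n →-dec (8 ℕ.≤? n ×-dec n ∈? map proj₁ certificates₃)) 45)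

valid₄ : ∀ {n} → n ℕ.< 48 → Valid₄ n → 8 ≤ n × n ∈ map proj₁ certificates₄
valid₄ = from-yes (ℕ.allUpTo? (λ n → (10 ℕ.≤? n ×-dec n ℕ.≤? 47) →-dec (8 ℕ.≤? n ×-dec n ∈? map proj₁ certificates₄)) 48)

lower : ∀ {n s ks} → 8 ≤ n → Unique ks → EvenPairs s ks →
  (∀ m → All (IsDistanceOf (layers (8 ℕ.+ m) ks)) (evens s)) → IsSDistanceSet n s (layers n ks)
lower 8≤n ks! even attained with m , refl ← ℕ.m≤n⇒∃[o]m+o≡n 8≤n = layers-distances (8 ℕ.+ m) ks! even (attained m)

lower₃ : ∀ n → 8 ≤ n → ∃ λ X → IsSDistanceSet n 3 X × length X ≡ bound₃ n
lower₃ n 8≤n =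
  layers n (1 ∷ 3 ∷ []) ,
  lower 8≤n (from-yes (unique? (1 ∷ 3 ∷ []))) (from-yes (evenPairs? 3 (1 ∷ 3 ∷ []))) attained₃ ,
  trans (length-layers n (1 ∷ 3 ∷ [])) (cong₂ _+_ (nC1≡n n) (ℕ.+-identityʳ (n C 3)))

lower₄ : ∀ n → 8 ≤ n → ∃ λ X → IsSDistanceSet n 4 X × length X ≡ bound₄ n
lower₄ n 8≤n =
  layers n (0 ∷ 2 ∷ 4 ∷ []) ,
  lower 8≤n (from-yes (unique? (0 ∷ 2 ∷ 4 ∷ []))) (from-yes (evenPairs? 4 (0 ∷ 2 ∷ 4 ∷ []))) attained₄ ,
  trans (length-layers n (0 ∷ 2 ∷ 4 ∷ [])) (cong (λ i → 1 + (n C 2 + i)) (ℕ.+-identityʳ (n C 4)))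

upper₃ : ∀ n → n ≤ 44 → n ∈ map proj₁ certificates₃ → ∀ X → IsSDistanceSet n 3 X → length X ≤ bound₃ n
upper₃ n n≤44 n∈ = check-sound {n} {44} 3 bound₃ certificates₃ n≤44 check₃ n∈

upper₄ : ∀ n → n ≤ 47 → n ∈ map proj₁ certificates₄ → ∀ X → IsSDistanceSet n 4 X → length X ≤ bound₄ n
upper₄ n n≤47 n∈ = check-sound {n} {47} 4 bound₄ certificates₄ n≤47 check₄ n∈

theorem3p2 : (∀ n → ((8 ≤ n × n ≤ 22) ⊎ (24 ≤ n × n ≤ 33) ⊎ n ≡ 36 ⊎ n ≡ 37 ⊎ n ≡ 44)
    → A-is n 3 (n + n C 3))
    × (∀ n → 10 ≤ n → n ≤ 47 → A-is n 4 (1 + n C 2 + n C 4))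
theorem3p2 =
  (λ n valid → let n≤44 = valid₃⇒≤44 valid in
    lower₃ n (proj₁ (valid₃ (s≤s n≤44) valid)) , upper₃ n n≤44 (proj₂ (valid₃ (s≤s n≤44) valid))) ,
  (λ n 10≤n n≤47 →
    lower₄ n (proj₁ (valid₄ (s≤s n≤47) (10≤n , n≤47))) , upper₄ n n≤47 (proj₂ (valid₄ (s≤s n≤47) (10≤n , n≤47))))
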